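{- For every integer $k > 0$ there is a constant $\varepsilon_k > 0$ such that every sufficiently large (in terms of $k$) finite point set $P$ in the plane $\mathbb{R}^2$ in general position contains $2k$ pairwise disjoint subsets $A_1,\ldots,A_k,B_1,\ldots,B_k \subset P$, each of size at least $\varepsilon_k |P|$, such that every pair of sets $A=\{a_1,\ldots,a_k\}$ and $B=\{b_1,\ldots,b_k\}$ with $a_i\in A_i$ and $b_i\in B_i$ for all $1\le i\le k$ is mutually avoiding. Moreover, $\varepsilon_k = \Omega(1/k^4)$, i.e. there is an absolute constant $c>0$ such that one can take $\varepsilon_k \ge c/k^4$ for every $k$.
   Context: A finite point set in the plane is in general position if no three of its members are collinear. For two disjoint point sets $A$ and $B$ in the plane, $A$ avoids $B$ if no line through a pair of (distinct) points of $A$ intersects the convex hull of $B$. The sets $A$ and $B$ are mutually avoiding if $A$ avoids $B$ and $B$ avoids $A$. -}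

module Defs where

open import Algebra.Bundles using (CommutativeRing; Semiring)
import Algebra.Definitions.RawSemiring as RawSemiringDefs
open import Data.Fin.Base using (Fin)
open import Data.Fin.Subset as Subset using (Subset)
open import Data.Nat.Base using (ℕ)
open import Data.Product.Base using (Σ-syntax; ∃-syntax; _×_; _,_; proj₁; proj₂)
open import Data.Product.Relation.Binary.Pointwise.NonDependent using (Pointwise)
open import Data.Vec.Functional using (Vector)
open import Level using (0ℓ) renaming (suc to lsuc)
open import Relation.Binary.Core using (Rel)
open import Relation.Binary.Construct.StrictToNonStrict as StrictToNonStrict using ()
open import Relation.Binary.PropositionalEquality.Core using (_≢_)
open import Relation.Binary.Structures using (IsStrictTotalOrder)
open import Relation.Nullary.Negation.Core using (¬_)
open import Relation.Unary using (Pred; Satisfiable; _∈_)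

-- The standard library has no real numbers.  They enter through their
-- categorical axiomatisation: a Dedekind-complete ordered field, unique up to
-- isomorphism.  The axioms are those of the classical reals; in particular the
-- order is decidable.
record CompleteOrderedField : Set (lsuc 0ℓ) where
  field
    commutativeRing : CommutativeRing 0ℓ 0ℓ

  open CommutativeRing commutativeRing public

  infix  4 _<_
  infix  9 _⁻¹
  infixl 7 _/_

  field
    0≉1        : ¬ (0# ≈ 1#)

    -- total, with an unspecified value at 0#
    _⁻¹        : Carrier → Carrier
    ⁻¹-inverse : ∀ x → ¬ (x ≈ 0#) → x * x ⁻¹ ≈ 1#

    _<_                : Rel Carrier 0ℓ
    isStrictTotalOrder : IsStrictTotalOrder _≈_ _<_
    +-monoˡ-<          : ∀ {x y} z → x < y → x + z < y + z
    *-pos              : ∀ {x y} → 0# < x → 0# < y → 0# < x * y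

  open StrictToNonStrict _≈_ _<_ public using (_≤_)

  UpperBound : Pred Carrier 0ℓ → Pred Carrier 0ℓ
  UpperBound S u = ∀ x → x ∈ S → x ≤ u

  field
    complete : (S : Pred Carrier 0ℓ) → Satisfiable S → Satisfiable (UpperBound S) →
               ∃[ s ] s ∈ UpperBound S × (∀ u → u ∈ UpperBound S → s ≤ u)

  open RawSemiringDefs (Semiring.rawSemiring semiring) public
    using (_^_; sum) renaming (_×_ to _·_)

  _/_ : Carrier → Carrier → Carrier
  x / y = x * y ⁻¹

  fromℕ : ℕ → Carrier
  fromℕ n = n · 1#

module Plane (ℝ : CompleteOrderedField) where

  open CompleteOrderedField ℝ

  Point : Set
  Point = Carrier × Carrier

  infix 4 _≈ₚ_
  _≈ₚ_ : Rel Point 0ℓ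
  _≈ₚ_ = Pointwise _≈_ _≈_

  PointSet : Set (lsuc 0ℓ)
  PointSet = Pred Point 0ℓ

  range : ∀ {n} → Vector Point n → PointSet
  range p x = ∃[ i ] x ≈ₚ p i

  -- the line u X + v Y = w
  record Line : Set where
    field
      u v w      : Carrier
      nontrivial : ¬ (u ≈ 0# × v ≈ 0#)

  points : Line → PointSet
  points l (x , y) = u * x + v * y ≈ w
    where open Line l

  Collinear : Point → Point → Point → Set
  Collinear x y z = ∃[ l ] x ∈ points l × y ∈ points l × z ∈ points l

  GeneralPosition : PointSet → Set
  GeneralPosition P = ∀ x y z → x ∈ P → y ∈ P → z ∈ P →
    ¬ (x ≈ₚ y) → ¬ (x ≈ₚ z) → ¬ (y ≈ₚ z) → ¬ Collinear x y z

  -- the set of all finite convex combinations of members of B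
  ConvexHull : PointSet → PointSet
  ConvexHull B z =
    Σ[ m ∈ ℕ ] Σ[ t ∈ Vector Carrier m ] Σ[ q ∈ Vector Point m ]
      (∀ i → 0# ≤ t i) × sum t ≈ 1# × (∀ i → q i ∈ B) ×
      z ≈ₚ (sum (λ i → t i * proj₁ (q i)) , sum (λ i → t i * proj₂ (q i)))

  Avoids : PointSet → PointSet → Set
  Avoids A B = ∀ a a′ → a ∈ A → a′ ∈ A → ¬ (a ≈ₚ a′) →
    ∀ l → a ∈ points l → a′ ∈ points l →
    ¬ (∃[ z ] z ∈ points l × z ∈ ConvexHull B)

  MutuallyAvoiding : PointSet → PointSet → Set
  MutuallyAvoiding A B = Avoids A B × Avoids B A

PairwiseDisjoint : {I : Set} {n : ℕ} → (I → Subset n) → Set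
PairwiseDisjoint C = ∀ s t → s ≢ t → Subset.Empty (C s Subset.∩ C t)

{-# OPTIONS --safe #-}
-- Cut P by vertical lines into a bounded number of clusters and shrink them,
-- each time by a factor 2, until every triple of clusters is oriented: all its
-- transversals are cups, or all are caps.  A Ramsey argument yields five clusters,
-- from left to right, with the three consecutive triples all cups or all caps.
-- Choose a point b in the third one.  In the projective coordinates
-- (u , w) = (1 / x , ± y / x) centred at b, the other four clusters form the
-- permutation pattern 2143.
--
-- By a grid version of the Erdős–Szekeres theorem, where the factor k⁴ is lost,
-- each of the four clusters contains k subclusters which are, in these
-- coordinates, pairwise increasing or pairwise decreasing.  If two clusters lie
-- in increasing position and both are decreasing, or the other way around, then
-- no line through two points of one meets the convex hull of the other.  In 2143
-- such a pair always exists: if it is neither {2 , 1} nor {4 , 3}, then each of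
-- these contains a decreasing cluster, and these two are in increasing position.
module Submission where

open import Algebra.Bundles using (CommutativeRing)
import Algebra.Properties.AbelianGroup as AbelianGroupProperties
import Algebra.Properties.Ring as RingProperties
import Algebra.Properties.Semiring.Mult as Mult
import Algebra.Solver.Ring as RingSolver
import Algebra.Solver.Ring.AlmostCommutativeRing as ACR
open import Data.Bool.Base using (Bool; true; false)
import Data.Bool.Properties as Bool
open import Data.Fin.Base as Fin using (Fin; zero; suc)
open import Data.Fin.Patterns using (0F; 1F; 2F; 3F)
import Data.Fin.Properties as Fin
open import Data.Fin.Subset as Subset using (Subset; _∈_; ∣_∣; ⊥; ⁅_⁆; _∪_)
open import Data.Fin.Subset.Properties
  using (∉⊥; x∈⁅x⁆; x∈⁅y⁆⇒x≡y; x∈p∪q⁻; x∈p∪q⁺; x∈p∩q⁻; p⊆q⇒∣p∣≤∣q∣; x∈p⇒∣p-x∣<∣p∣; x∈p∧x≢y⇒x∈p-y)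
open import Data.Integer.Base as ℤ using (ℤ; +_; -[1+_]; _⊖_; _◃_)
import Data.Integer.Properties as ℤ
open import Data.List.Base
  using (List; []; _∷_; length; _++_; take; drop; map; filter; foldr; tabulate; lookup; allFin; cartesianProduct)
import Data.List.Membership.Propositional as List
open import Data.List.Membership.DecPropositional using (_∈?_)
open import Data.List.Membership.Propositional.Properties
  using (∈-++⁺ˡ; ∈-++⁺ʳ; ∈-++⁻; ∈-∃++; ∈-lookup; ∈-filter⁻; ∈-cartesianProduct⁺; ∈-allFin)
import Data.List.Properties as List
open import Data.List.Relation.Binary.Permutation.Propositional as Perm using (_↭_; ↭-sym; ↭⇒↭ₛ)
import Data.List.Relation.Binary.Permutation.Propositional.Properties as Perm
import Data.List.Relation.Binary.Permutation.Setoid.Properties as Permₛ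
open import Data.List.Relation.Binary.Sublist.Propositional as Sublist using (_⊆_; []; _∷_; _∷ʳ_)
open import Data.List.Relation.Binary.Sublist.Propositional.Properties using (All-resp-⊆; take-⊆)
open import Data.List.Relation.Unary.All as All using (All; []; _∷_)
import Data.List.Relation.Unary.All.Properties as All
open import Data.List.Relation.Unary.AllPairs as AllPairs using (AllPairs; []; _∷_)
import Data.List.Relation.Unary.AllPairs.Properties as AllPairs
open import Data.List.Relation.Unary.Any as Any using (Any; here; there)
import Data.List.Relation.Unary.Any.Properties as Any
import Data.List.Relation.Unary.Sorted.TotalOrder.Properties as Sorted
open import Data.List.Relation.Unary.Unique.Propositional using (Unique)
import Data.List.Relation.Unary.Unique.Propositional.Properties as Unique
import Data.List.Sort as Sort
open import Data.Maybe.Base using (Maybe; just; nothing)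
open import Data.Nat.Base as ℕ using (ℕ; zero; suc; z≤n; s≤s)
import Data.Nat.DivMod as ℕ
import Data.Nat.Properties as ℕ
open import Data.Nat.Solver using (module +-*-Solver)
open import Data.Product.Base using (Σ-syntax; ∃-syntax; ∃₂; _×_; _,_; proj₁; proj₂)
open import Data.Sign.Base as Sign using (Sign)
open import Data.Sum.Base as Sum using (_⊎_; inj₁; inj₂; [_,_]′)
open import Data.Unit.Base using (⊤; tt)
open import Data.Vec.Functional using (Vector)
open import Defs
open import Function.Base using (_∘_; id; _on_)
open import Function.Definitions using (Injective)
open import Level using (0ℓ)
open import Relation.Binary.Bundles using (DecTotalOrder)
import Relation.Binary.Construct.On as On
import Relation.Binary.Construct.StrictToNonStrict as StrictToNonStrict
open import Relation.Binary.Core using (Rel)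
open import Relation.Binary.Definitions using (Transitive; Symmetric; tri<; tri≈; tri>)
open import Relation.Binary.PropositionalEquality.Core as ≡ using (_≡_; _≢_)
import Relation.Binary.PropositionalEquality.Properties as ≡
import Relation.Binary.Reasoning.Setoid as SetoidReasoning
open import Relation.Binary.Structures using (IsStrictTotalOrder)
open import Relation.Nullary.Decidable using (Dec; yes; no; _×-dec_; ¬?)
open import Relation.Nullary.Negation.Core using (¬_; contradiction)
open import Relation.Unary as Unary using (Pred; Decidable)


-- The obstacle is that nothing controls which direction Erdős-Szekeres returns on a given cluster,
-- while avoidance needs two clusters whose directions both fit their mutual position. Hence a
-- pattern on four clusters in which every outcome leaves a good pair. The pattern 2143 arises
-- because, seen from `b`, the reciprocal of the abscissa reverses the order on each side of `b` but
-- keeps the left side before the right one, while the slopes of the lines through `b` run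
-- monotonically through the four clusters. The vertical line through `b` goes to infinity and
-- separates the clusters, so convex hulls are not followed through the map. Only orientations are:
-- they change by a product of three factors, one per point and of constant sign on each cluster, so
-- lying on one side of a line survives. The numbers of clusters and of triples do not depend on
-- `k`, so all steps before the grid cost a constant factor. The exponent 4 is 2 + 2: Erdős-Szekeres
-- takes k² cells to return k of them, and to provide k² cells, k² columns must each hold k² times
-- the size of a cell.

-- Polynomial identities in commutative rings.

module IntegerCoefficients (R : CommutativeRing 0ℓ 0ℓ) where
  open CommutativeRing R
  open RingProperties ring
  open AbelianGroupProperties +-abelianGroup using (⁻¹-∙-comm; ⁻¹-involutive; ε⁻¹≈ε)
  open Mult semiring renaming (_×_ to _·_)
  open SetoidReasoning setoid

  ⟦_⟧ : ℤ → Carrier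
  ⟦ + n ⟧      = n · 1#
  ⟦ -[1+ n ] ⟧ = - (suc n · 1#)

  cancel-1+ : ∀ x y → (1# + x) + - (1# + y) ≈ x + - y
  cancel-1+ x y = begin
    (1# + x) + - (1# + y)     ≈⟨ +-cong (+-comm 1# x) (sym (⁻¹-∙-comm 1# y)) ⟩
    (x + 1#) + (- 1# + - y)   ≈⟨ +-assoc x 1# _ ⟩
    x + (1# + (- 1# + - y))   ≈⟨ +-congˡ (sym (+-assoc 1# (- 1#) (- y))) ⟩
    x + ((1# + - 1#) + - y)   ≈⟨ +-congˡ (+-congʳ (-‿inverseʳ 1#)) ⟩
    x + (0# + - y)            ≈⟨ +-congˡ (+-identityˡ (- y)) ⟩
    x + - y                   ∎

  ⊖-homo : ∀ m n → ⟦ m ⊖ n ⟧ ≈ m · 1# + - (n · 1#)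
  ⊖-homo zero    zero    = sym (-‿inverseʳ 0#)
  ⊖-homo zero    (suc n) = sym (+-identityˡ _)
  ⊖-homo (suc m) zero    = sym (trans (+-congˡ ε⁻¹≈ε) (+-identityʳ _))
  ⊖-homo (suc m) (suc n) = begin
    ⟦ suc m ⊖ suc n ⟧                ≡⟨ ≡.cong ⟦_⟧ (ℤ.[1+m]⊖[1+n]≡m⊖n m n) ⟩
    ⟦ m ⊖ n ⟧                        ≈⟨ ⊖-homo m n ⟩
    m · 1# + - (n · 1#)              ≈⟨ sym (cancel-1+ _ _) ⟩
    suc m · 1# + - (suc n · 1#)      ∎

  +-homo : ∀ i j → ⟦ i ℤ.+ j ⟧ ≈ ⟦ i ⟧ + ⟦ j ⟧
  +-homo (+ m)      (+ n)      = ×-homo-+ 1# m n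
  +-homo (+ m)      -[1+ n ]   = ⊖-homo m (suc n)
  +-homo -[1+ m ]   (+ n)      = trans (⊖-homo n (suc m)) (+-comm _ _)
  +-homo -[1+ m ]   -[1+ n ]   = begin
    - (suc (suc (m ℕ.+ n)) · 1#)         ≡⟨ ≡.cong (λ o → - (suc o · 1#)) (≡.sym (ℕ.+-suc m n)) ⟩
    - ((suc m ℕ.+ suc n) · 1#)           ≈⟨ -‿cong (×-homo-+ 1# (suc m) (suc n)) ⟩
    - (suc m · 1# + suc n · 1#)          ≈⟨ sym (⁻¹-∙-comm _ _) ⟩
    - (suc m · 1#) + - (suc n · 1#)      ∎

  +◃-homo : ∀ n → ⟦ Sign.+ ◃ n ⟧ ≈ n · 1#
  +◃-homo zero    = refl
  +◃-homo (suc n) = refl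

  -◃-homo : ∀ n → ⟦ Sign.- ◃ n ⟧ ≈ - (n · 1#)
  -◃-homo zero    = sym ε⁻¹≈ε
  -◃-homo (suc n) = refl

  *-homo : ∀ i j → ⟦ i ℤ.* j ⟧ ≈ ⟦ i ⟧ * ⟦ j ⟧
  *-homo (+ m)    (+ n)    = trans (+◃-homo (m ℕ.* n)) (×1-homo-* m n)
  *-homo (+ m)    -[1+ n ] = trans (-◃-homo (m ℕ.* suc n))
    (trans (-‿cong (×1-homo-* m (suc n))) (-‿distribʳ-* _ _))
  *-homo -[1+ m ] (+ n)    = trans (-◃-homo (suc m ℕ.* n))
    (trans (-‿cong (×1-homo-* (suc m) n)) (-‿distribˡ-* _ _))
  *-homo -[1+ m ] -[1+ n ] = begin
    ⟦ Sign.+ ◃ (suc m ℕ.* suc n) ⟧   ≈⟨ +◃-homo (suc m ℕ.* suc n) ⟩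
    (suc m ℕ.* suc n) · 1#           ≈⟨ ×1-homo-* (suc m) (suc n) ⟩
    suc m · 1# * suc n · 1#          ≈⟨ sym (⁻¹-involutive _) ⟩
    - (- (suc m · 1# * suc n · 1#))  ≈⟨ -‿cong (-‿distribˡ-* _ _) ⟩
    - (- (suc m · 1#) * suc n · 1#)  ≈⟨ -‿distribʳ-* _ _ ⟩
    - (suc m · 1#) * - (suc n · 1#)  ∎

  -‿homo : ∀ i → ⟦ ℤ.- i ⟧ ≈ - ⟦ i ⟧
  -‿homo (+ zero)  = sym ε⁻¹≈ε
  -‿homo (+ suc n) = refl
  -‿homo -[1+ n ]  = sym (⁻¹-involutive _)

  -- With integer coefficients, opposite terms of a polynomial cancel to a zero that can be
  -- recognised by computation, whatever the ring of values.
  morphism : ℤ.+-*-rawRing ACR.-Raw-AlmostCommutative⟶ ACR.fromCommutativeRing R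
  morphism = record
    { ⟦_⟧ = ⟦_⟧ ; +-homo = +-homo ; *-homo = *-homo ; -‿homo = -‿homo
    ; 0-homo = refl ; 1-homo = +-identityʳ 1# }

  weaklyDecidable : ∀ i j → Maybe (⟦ i ⟧ ≈ ⟦ j ⟧)
  weaklyDecidable i j with i ℤ.≟ j
  ... | yes i≡j = just (reflexive (≡.cong ⟦_⟧ i≡j))
  ... | no  _   = nothing

  open RingSolver ℤ.+-*-rawRing (ACR.fromCommutativeRing R) morphism weaklyDecidable public
    using (solve; _:=_; con; _:+_; _:*_; _:-_; :-_)

-- Inequalities in the ordered field.

module OrderedField (ℝ : CompleteOrderedField) where
  open CompleteOrderedField ℝ public hiding (zero)
  open IntegerCoefficients commutativeRing public
    using (solve; _:=_; con; _:+_; _:*_; _:-_; :-_)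
  module O = IsStrictTotalOrder isStrictTotalOrder
  private module S = StrictToNonStrict _≈_ _<_

  decTotalOrder : DecTotalOrder 0ℓ 0ℓ 0ℓ
  decTotalOrder = record { isDecTotalOrder = S.isDecTotalOrder isStrictTotalOrder }
  open DecTotalOrder decTotalOrder public
    using () renaming (refl to ≤-refl; trans to ≤-trans; total to ≤-total; antisym to ≤-antisym;
      reflexive to ≤-reflexive; _≟_ to _≈?_)

  ≤⇒≯ : ∀ {x y} → x ≤ y → ¬ (y < x)
  ≤⇒≯ (inj₁ x<y) y<x = O.asym x<y y<x
  ≤⇒≯ (inj₂ x≈y) y<x = O.irrefl (sym x≈y) y<x

  ≤∧≉⇒< : ∀ {x y} → x ≤ y → ¬ (x ≈ y) → x < y
  ≤∧≉⇒< (inj₁ x<y) _   = x<y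
  ≤∧≉⇒< (inj₂ x≈y) x≉y = contradiction x≈y x≉y

  <-≤-trans : ∀ {x y z} → x < y → y ≤ z → x < z
  <-≤-trans x<y (inj₁ y<z) = O.trans x<y y<z
  <-≤-trans x<y (inj₂ y≈z) = O.<-respʳ-≈ y≈z x<y

  ≤-resp : ∀ {x x′ y y′} → x ≈ x′ → y ≈ y′ → x ≤ y → x′ ≤ y′
  ≤-resp x≈x′ y≈y′ x≤y = ≤-trans (inj₂ (sym x≈x′)) (≤-trans x≤y (inj₂ y≈y′))

  <-resp : ∀ {x x′ y y′} → x ≈ x′ → y ≈ y′ → x < y → x′ < y′
  <-resp x≈x′ y≈y′ x<y = O.<-respˡ-≈ x≈x′ (O.<-respʳ-≈ y≈y′ x<y)

  +-monoˡ-≤ : ∀ {x y} z → x ≤ y → x + z ≤ y + z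
  +-monoˡ-≤ z (inj₁ x<y) = inj₁ (+-monoˡ-< z x<y)
  +-monoˡ-≤ z (inj₂ x≈y) = inj₂ (+-congʳ x≈y)

  +-mono-≤ : ∀ {x y z w} → x ≤ y → z ≤ w → x + z ≤ y + w
  +-mono-≤ {x} {y} {z} {w} x≤y z≤w = ≤-trans (+-monoˡ-≤ z x≤y)
    (≤-resp (+-comm z y) (+-comm w y) (+-monoˡ-≤ y z≤w))

  x<y⇒0<y-x : ∀ {x y} → x < y → 0# < y - x
  x<y⇒0<y-x {x} x<y = <-resp (-‿inverseʳ x) refl (+-monoˡ-< (- x) x<y)

  x≤y⇒0≤y-x : ∀ {x y} → x ≤ y → 0# ≤ y - x
  x≤y⇒0≤y-x {x} x≤y = ≤-resp (-‿inverseʳ x) refl (+-monoˡ-≤ (- x) x≤y)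

  x≤y⇒x-y≤0 : ∀ {x y} → x ≤ y → x - y ≤ 0#
  x≤y⇒x-y≤0 {x} {y} x≤y = ≤-resp refl (-‿inverseʳ y) (+-monoˡ-≤ (- y) x≤y)

  0≤y-x⇒x≤y : ∀ {x y} → 0# ≤ y - x → x ≤ y
  0≤y-x⇒x≤y {x} {y} h = ≤-resp (+-identityˡ x)
    (solve 2 (λ x y → y :- x :+ x := y) refl x y) (+-monoˡ-≤ x h)

  0<y-x⇒x<y : ∀ {x y} → 0# < y - x → x < y
  0<y-x⇒x<y {x} {y} h = <-resp (+-identityˡ x)
    (solve 2 (λ x y → y :- x :+ x := y) refl x y) (+-monoˡ-< x h)

  x-y≈0⇒x≈y : ∀ {x y} → x - y ≈ 0# → x ≈ y
  x-y≈0⇒x≈y {x} {y} h = trans (solve 2 (λ x y → x := x :- y :+ y) refl x y)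
    (trans (+-congʳ h) (+-identityˡ y))

  neg-mono-≤ : ∀ {x y} → x ≤ y → - y ≤ - x
  neg-mono-≤ {x} {y} x≤y = 0≤y-x⇒x≤y
    (≤-resp refl (solve 2 (λ x y → y :- x := :- x :- :- y) refl x y) (x≤y⇒0≤y-x x≤y))

  neg-nonneg : ∀ {x} → 0# ≤ x → - x ≤ 0#
  neg-nonneg {x} h = ≤-resp refl (solve 0 (:- con ℤ.0ℤ := con ℤ.0ℤ) refl) (neg-mono-≤ h)

  neg-nonpos : ∀ {x} → x ≤ 0# → 0# ≤ - x
  neg-nonpos {x} h = ≤-resp (solve 0 (:- con ℤ.0ℤ := con ℤ.0ℤ) refl) refl (neg-mono-≤ h)

  neg-neg : ∀ {x} → x < 0# → 0# < - x
  neg-neg {x} h = <-resp refl (+-identityˡ (- x)) (x<y⇒0<y-x h)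

  +-nonneg : ∀ {x y} → 0# ≤ x → 0# ≤ y → 0# ≤ x + y
  +-nonneg h k = ≤-resp (+-identityˡ 0#) refl (+-mono-≤ h k)

  *-nonneg : ∀ {x y} → 0# ≤ x → 0# ≤ y → 0# ≤ x * y
  *-nonneg (inj₁ h) (inj₁ k) = inj₁ (*-pos h k)
  *-nonneg {x} {y} (inj₂ h) _ = inj₂ (sym (trans (*-congʳ (sym h)) (zeroˡ y)))
  *-nonneg {x} {y} (inj₁ _) (inj₂ k) = inj₂ (sym (trans (*-congˡ (sym k)) (zeroʳ x)))

  *-nonneg-nonpos : ∀ {x y} → 0# ≤ x → y ≤ 0# → x * y ≤ 0#
  *-nonneg-nonpos {x} {y} h k = ≤-resp (solve 2 (λ x y → :- (x :* :- y) := x :* y) refl x y) refl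
    (neg-nonneg (*-nonneg h (neg-nonpos k)))

  *-nonpos-nonneg : ∀ {x y} → x ≤ 0# → 0# ≤ y → x * y ≤ 0#
  *-nonpos-nonneg h k = ≤-resp (*-comm _ _) refl (*-nonneg-nonpos k h)

  *-nonpos : ∀ {x y} → x ≤ 0# → y ≤ 0# → 0# ≤ x * y
  *-nonpos {x} {y} h k = ≤-resp refl (solve 2 (λ x y → :- x :* :- y := x :* y) refl x y)
    (*-nonneg (neg-nonpos h) (neg-nonpos k))

  *-monoˡ-≤ : ∀ {x y z} → 0# ≤ z → x ≤ y → z * x ≤ z * y
  *-monoˡ-≤ {x} {y} {z} h k = 0≤y-x⇒x≤y
    (≤-resp refl (solve 3 (λ x y z → z :* (y :- x) := z :* y :- z :* x) refl x y z)
      (*-nonneg h (x≤y⇒0≤y-x k)))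

  0<1 : 0# < 1#
  0<1 with O.compare 0# 1#
  ... | tri< h _ _ = h
  ... | tri≈ _ h _ = contradiction h 0≉1
  ... | tri> _ _ h = contradiction
    (<-resp refl (trans (solve 1 (λ x → :- x :* :- x := x :* x) refl 1#) (*-identityˡ 1#))
      (*-pos (neg-neg h) (neg-neg h)))
    (O.asym h)

  >⇒≉ : ∀ {x y} → x < y → ¬ (y ≈ x)
  >⇒≉ x<y y≈x = O.irrefl (sym y≈x) x<y

  ⁻¹-pos : ∀ {x} → 0# < x → 0# < x ⁻¹
  ⁻¹-pos {x} h with O.compare 0# (x ⁻¹)
  ... | tri< k _ _ = k
  ... | tri≈ _ k _ = contradiction
    (trans (sym (zeroʳ x)) (trans (*-congˡ k) (⁻¹-inverse x (>⇒≉ h)))) 0≉1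
  ... | tri> _ _ k = contradiction 0<1 (≤⇒≯
    (≤-resp (⁻¹-inverse x (>⇒≉ h)) refl (*-nonneg-nonpos (inj₁ h) (inj₁ k))))

  *-cancel-≉0 : ∀ {x y} → ¬ (x ≈ 0#) → x * y ≈ 0# → y ≈ 0#
  *-cancel-≉0 {x} {y} x≉0 h = begin
    y               ≈⟨ sym (*-identityˡ y) ⟩
    1# * y          ≈⟨ *-congʳ (sym (⁻¹-inverse x x≉0)) ⟩
    x * x ⁻¹ * y    ≈⟨ solve 3 (λ x i y → x :* i :* y := i :* (x :* y)) refl x (x ⁻¹) y ⟩
    x ⁻¹ * (x * y)  ≈⟨ *-congˡ h ⟩
    x ⁻¹ * 0#       ≈⟨ zeroʳ _ ⟩
    0#              ∎
    where open SetoidReasoning setoid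

  /-≤⇒ : ∀ {w d h} → 0# < d → w / d ≤ h → w ≤ d * h
  /-≤⇒ {w} {d} {h} 0<d k = ≤-resp
    (trans (solve 3 (λ w d i → d :* (w :* i) := w :* (d :* i)) refl w d (d ⁻¹))
      (trans (*-congˡ (⁻¹-inverse d (>⇒≉ 0<d))) (*-identityʳ w)))
    refl (*-monoˡ-≤ (inj₁ 0<d) k)

  ≤-/⇒ : ∀ {w d h} → 0# < d → h ≤ w / d → d * h ≤ w
  ≤-/⇒ {w} {d} {h} 0<d k = ≤-resp refl
    (trans (solve 3 (λ w d i → d :* (w :* i) := w :* (d :* i)) refl w d (d ⁻¹))
      (trans (*-congˡ (⁻¹-inverse d (>⇒≉ 0<d))) (*-identityʳ w)))
    (*-monoˡ-≤ (inj₁ 0<d) k)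

-- Orientation of triples and lines missing a convex hull.

module Orientation (ℝ : CompleteOrderedField) where
  open OrderedField ℝ
  open Plane ℝ

  cross : Carrier → Carrier → Carrier → Carrier → Carrier
  cross a b c d = a * d - c * b

  -- Twice the signed area of the triangle, positive when it is traversed counterclockwise.
  orient : Point → Point → Point → Carrier
  orient (x₁ , y₁) (x₂ , y₂) (x₃ , y₃) = cross (x₂ - x₁) (y₂ - y₁) (x₃ - x₁) (y₃ - y₁)

  cross-cong : ∀ {a a′ b b′ c c′ d d′} → a ≈ a′ → b ≈ b′ → c ≈ c′ → d ≈ d′ →
               cross a b c d ≈ cross a′ b′ c′ d′
  cross-cong p q r s = +-cong (*-cong p s) (-‿cong (*-cong r q))

  orient-cong : ∀ {a a′ b b′ c c′} → a ≈ₚ a′ → b ≈ₚ b′ → c ≈ₚ c′ → orient a b c ≈ orient a′ b′ c′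
  orient-cong (p₁ , p₂) (q₁ , q₂) (r₁ , r₂) =
    cross-cong (q₁ -′ p₁) (q₂ -′ p₂) (r₁ -′ p₁) (r₂ -′ p₂)
    where
    infixl 6 _-′_
    _-′_ : ∀ {x x′ y y′} → x ≈ x′ → y ≈ y′ → x - y ≈ x′ - y′
    p -′ q = +-cong p (-‿cong q)

  orient-swap : ∀ a b c → orient b a c ≈ - orient a b c
  orient-swap (x₁ , y₁) (x₂ , y₂) (x₃ , y₃) =
    solve 6 (λ x₁ y₁ x₂ y₂ x₃ y₃ →
        (x₁ :- x₂) :* (y₃ :- y₂) :- (x₃ :- x₂) :* (y₁ :- y₂)
        := :- ((x₂ :- x₁) :* (y₃ :- y₁) :- (x₃ :- x₁) :* (y₂ :- y₁)))
      refl x₁ y₁ x₂ y₂ x₃ y₃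

  -- As in Cramer's rule, `u` and `v` times the determinant are combinations of the two vanishing
  -- values of the linear form, and at least one of these coefficients can be cancelled.
  kernel⇒cross≈0 : ∀ {u v P Q X Y} → ¬ (u ≈ 0# × v ≈ 0#) →
                   u * P + v * Q ≈ 0# → u * X + v * Y ≈ 0# → cross P Q X Y ≈ 0#
  kernel⇒cross≈0 {u} {v} {P} {Q} {X} {Y} nontrivial p q with u ≈? 0#
  ... | no u≉0 = *-cancel-≉0 u≉0 (begin
    u * cross P Q X Y
      ≈⟨ solve 6 (λ u v P Q X Y → u :* (P :* Y :- X :* Q)
                   := (u :* P :+ v :* Q) :* Y :- (u :* X :+ v :* Y) :* Q)
           refl u v P Q X Y ⟩
    (u * P + v * Q) * Y - (u * X + v * Y) * Q
      ≈⟨ +-cong (*-congʳ p) (-‿cong (*-congʳ q)) ⟩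
    0# * Y - 0# * Q
      ≈⟨ trans (+-cong (zeroˡ Y) (-‿cong (zeroˡ Q))) (-‿inverseʳ 0#) ⟩
    0# ∎)
    where open SetoidReasoning setoid
  ... | yes u≈0 = *-cancel-≉0 (λ v≈0 → nontrivial (u≈0 , v≈0)) (begin
    v * cross P Q X Y
      ≈⟨ solve 6 (λ u v P Q X Y → v :* (P :* Y :- X :* Q)
                   := P :* (u :* X :+ v :* Y) :- X :* (u :* P :+ v :* Q))
           refl u v P Q X Y ⟩
    P * (u * X + v * Y) - X * (u * P + v * Q)
      ≈⟨ +-cong (*-congˡ q) (-‿cong (*-congˡ p)) ⟩
    P * 0# - X * 0#
      ≈⟨ trans (+-cong (zeroʳ P) (-‿cong (zeroʳ X))) (-‿inverseʳ 0#) ⟩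
    0# ∎)
    where open SetoidReasoning setoid

  on-line⇒orient≈0 : ∀ {a b c} l → a Unary.∈ points l → b Unary.∈ points l → c Unary.∈ points l → orient a b c ≈ 0#
  on-line⇒orient≈0 l a∈l b∈l c∈l = kernel⇒cross≈0 nontrivial (along a∈l b∈l) (along a∈l c∈l)
    where
    open SetoidReasoning setoid
    open Line l
    along : ∀ {x y x′ y′} → u * x + v * y ≈ w → u * x′ + v * y′ ≈ w →
            u * (x′ - x) + v * (y′ - y) ≈ 0#
    along {x} {y} {x′} {y′} p q = begin
      u * (x′ - x) + v * (y′ - y)
        ≈⟨ solve 6 (λ u v x y x′ y′ → u :* (x′ :- x) :+ v :* (y′ :- y)
                     := (u :* x′ :+ v :* y′) :- (u :* x :+ v :* y)) refl u v x y x′ y′ ⟩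
      (u * x′ + v * y′) - (u * x + v * y)  ≈⟨ +-cong q (-‿cong p) ⟩
      w - w                                ≈⟨ -‿inverseʳ w ⟩
      0#                                   ∎

  orient≈0⇒collinear : ∀ {a b c} → ¬ (a ≈ₚ b) → orient a b c ≈ 0# → Collinear a b c
  orient≈0⇒collinear {x₁ , y₁} {x₂ , y₂} {x₃ , y₃} a≉b h = l , refl ,
    trans (solve 4 (λ x₁ y₁ x₂ y₂ →
        (y₁ :- y₂) :* x₂ :+ (x₂ :- x₁) :* y₂ := (y₁ :- y₂) :* x₁ :+ (x₂ :- x₁) :* y₁)
      refl x₁ y₁ x₂ y₂) refl ,
    (begin
      (y₁ - y₂) * x₃ + (x₂ - x₁) * y₃
        ≈⟨ solve 6 (λ x₁ y₁ x₂ y₂ x₃ y₃ →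
             (y₁ :- y₂) :* x₃ :+ (x₂ :- x₁) :* y₃ :=
             ((x₂ :- x₁) :* (y₃ :- y₁) :- (x₃ :- x₁) :* (y₂ :- y₁))
               :+ ((y₁ :- y₂) :* x₁ :+ (x₂ :- x₁) :* y₁)) refl x₁ y₁ x₂ y₂ x₃ y₃ ⟩
      orient (x₁ , y₁) (x₂ , y₂) (x₃ , y₃) + ((y₁ - y₂) * x₁ + (x₂ - x₁) * y₁)
        ≈⟨ +-congʳ h ⟩
      0# + ((y₁ - y₂) * x₁ + (x₂ - x₁) * y₁)
        ≈⟨ +-identityˡ _ ⟩
      (y₁ - y₂) * x₁ + (x₂ - x₁) * y₁ ∎)
    where
    open SetoidReasoning setoid
    l : Line
    l = record
      { u = y₁ - y₂ ; v = x₂ - x₁ ; w = (y₁ - y₂) * x₁ + (x₂ - x₁) * y₁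
      ; nontrivial = λ (p , q) → a≉b
          ( sym (x-y≈0⇒x≈y q) , x-y≈0⇒x≈y p ) }

  -- `orient a b` is affine in its last argument. The weights of a tail no longer add up to 1, so
  -- the induction runs on the homogeneous version `affine`, where the constant term carries the
  -- factor `sum t`.
  hull-orient : ∀ (a b : Point) {m} (t : Vector Carrier m) (q : Vector Point m) →
    sum t ≈ 1# →
    orient a b (sum (λ i → t i * proj₁ (q i)) , sum (λ i → t i * proj₂ (q i)))
      ≈ sum (λ i → t i * orient a b (q i))
  hull-orient (x₁ , y₁) (x₂ , y₂) t q Σt≈1 = begin
    (x₂ - x₁) * (SY - y₁) - (SX - x₁) * (y₂ - y₁)
      ≈⟨ solve 6 (λ P Q x₁ y₁ SX SY → P :* (SY :- y₁) :- (SX :- x₁) :* Q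
            := P :* SY :- Q :* SX :- (P :* y₁ :- Q :* x₁)) refl (x₂ - x₁) (y₂ - y₁) x₁ y₁ SX SY ⟩
    P * SY - Q * SX - R
      ≈⟨ +-congˡ (-‿cong (sym (trans (*-congʳ Σt≈1) (*-identityˡ R)))) ⟩
    P * SY - Q * SX - sum t * R
      ≈⟨ affine t q ⟩
    sum (λ i → t i * orient (x₁ , y₁) (x₂ , y₂) (q i)) ∎
    where
    open SetoidReasoning setoid
    SX = sum (λ i → t i * proj₁ (q i))
    SY = sum (λ i → t i * proj₂ (q i))
    P = x₂ - x₁
    Q = y₂ - y₁
    R = P * y₁ - Q * x₁
    affine : ∀ {m} (t : Vector Carrier m) (q : Vector Point m) →
      P * sum (λ i → t i * proj₂ (q i)) - Q * sum (λ i → t i * proj₁ (q i)) - sum t * R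
        ≈ sum (λ i → t i * orient (x₁ , y₁) (x₂ , y₂) (q i))
    affine {zero} t q = solve 3 (λ P Q R → P :* con ℤ.0ℤ :- Q :* con ℤ.0ℤ :- con ℤ.0ℤ :* R := con ℤ.0ℤ)
      refl P Q R
    affine {suc m} t q = begin
      P * (t₀ * Y + SY′) - Q * (t₀ * X + SX′) - (t₀ + S′) * R
        ≈⟨ solve 9 (λ P Q R t₀ X Y S′ SX′ SY′ →
             P :* (t₀ :* Y :+ SY′) :- Q :* (t₀ :* X :+ SX′) :- (t₀ :+ S′) :* R
             := t₀ :* (P :* Y :- Q :* X :- R) :+ (P :* SY′ :- Q :* SX′ :- S′ :* R))
             refl P Q R t₀ X Y S′ SX′ SY′ ⟩
      t₀ * (P * Y - Q * X - R) + (P * SY′ - Q * SX′ - S′ * R)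
        ≈⟨ +-cong (*-congˡ (solve 6 (λ P Q x₁ y₁ X Y → P :* Y :- Q :* X :- (P :* y₁ :- Q :* x₁)
              := P :* (Y :- y₁) :- (X :- x₁) :* Q) refl P Q x₁ y₁ X Y)) (affine (t ∘ suc) (q ∘ suc)) ⟩
      t₀ * cross P Q (X - x₁) (Y - y₁) + sum (λ i → t (suc i) * orient (x₁ , y₁) (x₂ , y₂) (q (suc i))) ∎
      where
      t₀ = t zero
      X = proj₁ (q zero)
      Y = proj₂ (q zero)
      S′ = sum (t ∘ suc)
      SX′ = sum (λ i → t (suc i) * proj₁ (q (suc i)))
      SY′ = sum (λ i → t (suc i) * proj₂ (q (suc i)))

  sum-nonneg : ∀ {m} (t : Vector Carrier m) → (∀ i → 0# ≤ t i) → 0# ≤ sum t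
  sum-nonneg {zero}  t h = ≤-refl
  sum-nonneg {suc m} t h = +-nonneg (h zero) (sum-nonneg (t ∘ suc) (h ∘ suc))

  -- A positive total forces some positive weight. Leading zero weights are skipped until it is met.
  weighted-sum-pos : ∀ {m} (t d : Vector Carrier m) → (∀ i → 0# ≤ t i) → (∀ i → 0# < d i) →
                     0# < sum t → 0# < sum (λ i → t i * d i)
  weighted-sum-pos {zero}  t d _  _  h = contradiction h (O.irrefl refl)
  weighted-sum-pos {suc m} t d t≥0 d>0 h with t≥0 zero
  ... | inj₁ 0<t₀ = <-≤-trans (*-pos 0<t₀ (d>0 zero))
    (≤-resp (+-identityʳ _) refl (+-mono-≤ ≤-refl
      (sum-nonneg (λ i → t (suc i) * d (suc i)) λ i → *-nonneg (t≥0 (suc i)) (inj₁ (d>0 (suc i))))))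
  ... | inj₂ 0≈t₀ = <-resp refl
    (sym (trans (+-congʳ (trans (*-congʳ (sym 0≈t₀)) (zeroˡ (d zero)))) (+-identityˡ _)))
    (weighted-sum-pos (t ∘ suc) (d ∘ suc) (t≥0 ∘ suc) (d>0 ∘ suc)
      (<-resp refl (trans (+-congʳ (sym 0≈t₀)) (+-identityˡ _)) h))

  -- A point of the hull on the line would have orientation zero with `a` and `b`, yet this
  -- orientation is a convex combination of positive numbers.
  left-of⇒misses-hull : ∀ {a b : Point} {B : PointSet} → (∀ q → q Unary.∈ B → 0# < orient a b q) →
    ∀ l → a Unary.∈ points l → b Unary.∈ points l → ¬ (∃[ z ] z Unary.∈ points l × z Unary.∈ ConvexHull B)
  left-of⇒misses-hull {a} {b} left l a∈l b∈l (z , z∈l , m , t , q , t≥0 , Σt≈1 , q∈B , z≈) =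
    O.irrefl
      (trans (sym (on-line⇒orient≈0 l a∈l b∈l z∈l))
        (trans (orient-cong {a} {a} {b} {b} {z} (refl , refl) (refl , refl) z≈)
          (hull-orient a b t q Σt≈1)))
      (weighted-sum-pos t (λ i → orient a b (q i)) t≥0 (λ i → left (q i) (q∈B i))
        (<-resp refl (sym Σt≈1) 0<1))

  SameSide : ∀ {m} → Point → Point → Vector Point m → Set
  SameSide a b β = (∀ j → 0# < orient a b (β j)) ⊎ (∀ j → orient a b (β j) < 0#)

  sameSide⇒avoids : ∀ {k m} (α : Vector Point k) (β : Vector Point m) →
    (∀ i j → i ≢ j → SameSide (α i) (α j) β) → Avoids (range α) (range β)
  sameSide⇒avoids α β h a b (i , a≈) (j , b≈) a≉b l a∈l b∈l =
    go (h i j λ { ≡.refl → a≉b (trans (proj₁ a≈) (sym (proj₁ b≈)) , trans (proj₂ a≈) (sym (proj₂ b≈))) })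
    where
    move : ∀ {q} {c} → q ≈ₚ c → orient (α i) (α j) c ≈ orient a b q
    move {q} {c} q≈c = sym (orient-cong {a} {α i} {b} {α j} {q} {c} a≈ b≈ q≈c)
    go : SameSide (α i) (α j) β → _
    go (inj₁ pos) = left-of⇒misses-hull {a} {b} {range β}
      (λ { q (r , q≈) → <-resp refl (move {q} q≈) (pos r) }) l a∈l b∈l
    go (inj₂ neg) = left-of⇒misses-hull {b} {a} {range β}
      (λ { q (r , q≈) → <-resp refl
        (trans (-‿cong (move {q} q≈)) (sym (orient-swap a b q))) (neg-neg (neg r)) }) l b∈l a∈l

-- Charts and the avoidance criterion for monotone families.

module Configuration (ℝ : CompleteOrderedField) {n : ℕ} (p : Vector (Plane.Point ℝ) n) where
  open OrderedField ℝ
  open Plane ℝ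
  open Orientation ℝ

  Indices : Set
  Indices = List (Fin n)

  det : Fin n → Fin n → Fin n → Carrier
  det i j l = orient (p i) (p j) (p l)

  Sep : (Fin n → Carrier) → Indices → Indices → Set
  Sep f A B = ∀ {a b} → a List.∈ A → b List.∈ B → f a ≤ f b

  -- General position in the form used below: clusters are mostly compared by weak inequalities, and
  -- a determinant known to be nonzero turns a weak sign into a strict one.
  NonDegenerate : Set
  NonDegenerate = ∀ {i j l} → i ≢ j → i ≢ l → j ≢ l → ¬ (det i j l ≈ 0#)

  nonDegenerate : Injective _≡_ _≈ₚ_ p → GeneralPosition (range p) → NonDegenerate
  nonDegenerate inj gp {i} {j} {l} i≢j i≢l j≢l h =
    gp (p i) (p j) (p l) (i , (refl , refl)) (j , (refl , refl)) (l , (refl , refl))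
      (i≢j ∘ inj) (i≢l ∘ inj) (j≢l ∘ inj)
      (orient≈0⇒collinear {p i} {p j} {p l} (i≢j ∘ inj) h)

  ConstSign : ∀ {m} → Vector Carrier m → Set
  ConstSign f = (∀ i → 0# ≤ f i) ⊎ (∀ i → f i ≤ 0#)

  constSign-const : ∀ {m} c → ConstSign {m} (λ _ → c)
  constSign-const c = Sum.map (λ h _ → h) (λ h _ → h) (≤-total 0# c)

  constSign-* : ∀ {m} {f g : Vector Carrier m} → ConstSign f → ConstSign g → ConstSign (λ i → f i * g i)
  constSign-* (inj₁ f) (inj₁ g) = inj₁ λ i → *-nonneg (f i) (g i)
  constSign-* (inj₁ f) (inj₂ g) = inj₂ λ i → *-nonneg-nonpos (f i) (g i)
  constSign-* (inj₂ f) (inj₁ g) = inj₂ λ i → *-nonpos-nonneg (f i) (g i)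
  constSign-* (inj₂ f) (inj₂ g) = inj₁ λ i → *-nonpos (f i) (g i)

  ConstSignOn : (Fin n → Carrier) → Indices → Set
  ConstSignOn d U = (∀ {x} → x List.∈ U → 0# ≤ d x) ⊎ (∀ {x} → x List.∈ U → d x ≤ 0#)

  ConstSignOn-neg : ∀ {d U} → ConstSignOn d U → ConstSignOn (λ i → - d i) U
  ConstSignOn-neg (inj₁ h) = inj₂ λ x∈ → neg-nonneg (h x∈)
  ConstSignOn-neg (inj₂ h) = inj₁ λ x∈ → neg-nonpos (h x∈)

  -- Coordinates u, w in which the orientation of a triple is, up to signs
  -- depending on the single points only, the orientation of the triple (u , w).
  record Chart (Dom : Fin n → Set) : Set where
    field
      u w d  : Fin n → Carrier
      det≈ : ∀ {i j l} → Dom i → Dom j → Dom l →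
             det i j l ≈ d i * d j * d l * cross (u j - u i) (w j - w i) (u l - u i) (w l - w i)

  -- Reflecting `w` reverses orientation in the chart. Negating `d` compensates, because `d` enters
  -- with an odd number of factors.
  flip-w : ∀ {Dom} → Chart Dom → Chart Dom
  flip-w c = record
    { u = u ; w = λ i → - w i ; d = λ i → - d i
    ; det≈ = λ {i} {j} {l} Di Dj Dl → trans (det≈ Di Dj Dl)
        (trans (solve 4 (λ x y z k → x :* y :* z :* k := :- x :* :- y :* :- z :* :- k) refl
                 (d i) (d j) (d l) _)
          (*-congˡ (solve 5 (λ wi wj wl P X →
            :- (P :* (wl :- wi) :- X :* (wj :- wi))
            := P :* (:- wl :- :- wi) :- X :* (:- wj :- :- wi)) refl (w i) (w j) (w l) _ _)))
    }
    where open Chart c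

  record Family (U : Indices) (k q : ℕ) : Set where
    field
      cell     : Fin k → Indices
      cell⊆    : ∀ i {x} → x List.∈ cell i → x List.∈ U
      unique   : ∀ i → Unique (cell i)
      size     : ∀ i → q ℕ.≤ length (cell i)
      disjoint : ∀ {i j} → i ≢ j → ∀ {x} → x List.∈ cell i → ¬ (x List.∈ cell j)

  open Family

  record AvoidingFamilies (k q : ℕ) : Set where
    field
      {U V}    : Indices
      F        : Family U k q
      G        : Family V k q
      U∩V=∅    : ∀ {x} → x List.∈ U → ¬ (x List.∈ V)
      avoiding : (α β : Fin k → Fin n) → (∀ i → α i List.∈ cell F i) → (∀ i → β i List.∈ cell G i) →
                 MutuallyAvoiding (range (p ∘ α)) (range (p ∘ β))

  Increasing Decreasing : ∀ {U k q} → (u w : Fin n → Carrier) → Family U k q → Set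
  Increasing u w F = ∀ {i j} → i ≢ j →
    (Sep u (cell F i) (cell F j) × Sep w (cell F i) (cell F j)) ⊎
    (Sep u (cell F j) (cell F i) × Sep w (cell F j) (cell F i))
  Decreasing u w F = ∀ {i j} → i ≢ j →
    (Sep u (cell F i) (cell F j) × Sep w (cell F j) (cell F i)) ⊎
    (Sep u (cell F j) (cell F i) × Sep w (cell F i) (cell F j))

  module _ {Dom : Fin n → Set} (c : Chart Dom) (nondeg : NonDegenerate) where
    open Chart c

    SouthEast : Fin n → Fin n → Set
    SouthEast a a′ = u a ≤ u a′ × w a′ ≤ w a

    _≼_ : Fin n → Fin n → Set
    a ≼ b = u a ≤ u b × w a ≤ w b

    module _ {m a a′} (β : Fin m → Fin n) (Da : Dom a) (Da′ : Dom a′) (Dβ : ∀ i → Dom (β i))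
             (a≢a′ : a ≢ a′) (a∉β : ∀ i → a ≢ β i) (a′∉β : ∀ i → a′ ≢ β i)
             (dβ : ConstSign (d ∘ β)) where

      -- In the chart the line through `a` and `a′` does not rise, so the points to the north-east
      -- of both lie on one side of it, and likewise those to the south-west. The determinant in the
      -- plane differs by `d a * d a′ * d (β i)`, whose sign does not depend on `i`.
      southEast⇒sameSide : SouthEast a a′ → (∀ i → a ≼ β i × a′ ≼ β i) ⊎ (∀ i → β i ≼ a × β i ≼ a′) →
                           SameSide (p a) (p a′) (p ∘ β)
      southEast⇒sameSide (ua≤ , wa≥) h = Sum.map
        (λ s i → ≤∧≉⇒< (≤-resp refl (sym (det≈ Da Da′ (Dβ i))) (s i)) (λ 0≈ → nz i (sym 0≈)))
        (λ s i → ≤∧≉⇒< (≤-resp (sym (det≈ Da Da′ (Dβ i))) refl (s i)) (nz i))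
        (constSign-* (constSign-* (constSign-const (d a * d a′)) dβ) (crossSign h))
        where
        nz : ∀ i → ¬ (det a a′ (β i) ≈ 0#)
        nz i = nondeg a≢a′ (a∉β i) (a′∉β i)
        crossSign : (∀ i → a ≼ β i × a′ ≼ β i) ⊎ (∀ i → β i ≼ a × β i ≼ a′) →
          ConstSign (λ i → cross (u a′ - u a) (w a′ - w a) (u (β i) - u a) (w (β i) - w a))
        crossSign (inj₁ h) = inj₁ λ i → +-nonneg
          (*-nonneg (x≤y⇒0≤y-x ua≤) (x≤y⇒0≤y-x (proj₂ (proj₁ (h i)))))
          (neg-nonpos (*-nonneg-nonpos (x≤y⇒0≤y-x (proj₁ (proj₁ (h i)))) (x≤y⇒x-y≤0 wa≥)))
        crossSign (inj₂ h) = inj₂ λ i → x≤y⇒x-y≤0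
          (≤-trans (*-nonneg-nonpos (x≤y⇒0≤y-x ua≤) (x≤y⇒x-y≤0 (proj₂ (proj₁ (h i)))))
                   (*-nonpos (x≤y⇒x-y≤0 (proj₁ (proj₁ (h i)))) (x≤y⇒x-y≤0 wa≥)))

    sameSide-swap : ∀ {m} {a b} {β : Vector Point m} → SameSide a b β → SameSide b a β
    sameSide-swap {a = a} {b} {β} (inj₁ h) = inj₂ λ i →
      <-resp (sym (orient-swap a b (β i))) refl
        (0<y-x⇒x<y (<-resp refl (solve 1 (λ x → x := con ℤ.0ℤ :- :- x) refl _) (h i)))
    sameSide-swap {a = a} {b} {β} (inj₂ h) = inj₁ λ i →
      <-resp refl (sym (orient-swap a b (β i))) (neg-neg (h i))

    decreasing⇒avoids : ∀ {U k q m} (F : Family U k q) → Decreasing u w F →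
      (α : Fin k → Fin n) → (∀ i → α i List.∈ cell F i) →
      (β : Fin m → Fin n) → (∀ {a} → a List.∈ U → Dom a) → (∀ j → Dom (β j)) →
      (∀ {a} → a List.∈ U → ∀ j → a ≢ β j) → ConstSign (d ∘ β) →
      (∀ {a} → a List.∈ U → ∀ j → a ≼ β j) ⊎ (∀ {a} → a List.∈ U → ∀ j → β j ≼ a) →
      Avoids (range (p ∘ α)) (range (p ∘ β))
    decreasing⇒avoids {U} F dec α α∈ β DU Dβ U∌β dβ ord = sameSide⇒avoids (p ∘ α) (p ∘ β) side
      where
      α∈U : ∀ i → α i List.∈ U
      α∈U i = cell⊆ F i (α∈ i)
      α-distinct : ∀ {i j} → i ≢ j → α i ≢ α j
      α-distinct {i} {j} i≢j αi≡αj = disjoint F i≢j (α∈ i) (≡.subst (List._∈ cell F j) (≡.sym αi≡αj) (α∈ j))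
      ord′ : ∀ i j → (∀ r → α i ≼ β r × α j ≼ β r) ⊎ (∀ r → β r ≼ α i × β r ≼ α j)
      ord′ i j = Sum.map (λ h r → h (α∈U i) r , h (α∈U j) r) (λ h r → h (α∈U i) r , h (α∈U j) r) ord
      ordered : ∀ i j → i ≢ j → SouthEast (α i) (α j) → SameSide (p (α i)) (p (α j)) (p ∘ β)
      ordered i j i≢j se = southEast⇒sameSide β (DU (α∈U i)) (DU (α∈U j)) Dβ (α-distinct i≢j)
        (U∌β (α∈U i)) (U∌β (α∈U j)) dβ se (ord′ i j)
      side : ∀ i j → i ≢ j → SameSide (p (α i)) (p (α j)) (p ∘ β)
      side i j i≢j with dec i≢j
      ... | inj₁ (s , t) = ordered i j i≢j (s (α∈ i) (α∈ j) , t (α∈ j) (α∈ i))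
      ... | inj₂ (s , t) = sameSide-swap {a = p (α j)} {p (α i)} {p ∘ β}
        (ordered j i (i≢j ∘ ≡.sym) (s (α∈ j) (α∈ i) , t (α∈ i) (α∈ j)))

    decreasing-pair : ∀ {U V k q} → (∀ {a} → a List.∈ U → Dom a) → (∀ {a} → a List.∈ V → Dom a) →
      (∀ {x} → x List.∈ U → ¬ (x List.∈ V)) → ConstSignOn d U → ConstSignOn d V →
      Sep u U V → Sep w U V →
      (F : Family U k q) → Decreasing u w F → (G : Family V k q) → Decreasing u w G →
      AvoidingFamilies k q
    decreasing-pair {U} {V} DU DV U∩V=∅ dU dV su sw F decF G decG = record
      { F = F ; G = G ; U∩V=∅ = U∩V=∅
      ; avoiding = λ α β α∈ β∈ →
          let α∈U = λ i → cell⊆ F i (α∈ i)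
              β∈V = λ i → cell⊆ G i (β∈ i)
          in
          decreasing⇒avoids F decF α α∈ β DU (λ j → DV (β∈V j))
            (λ a∈U j a≡β → U∩V=∅ a∈U (≡.subst (List._∈ V) (≡.sym a≡β) (β∈V j)))
            (Sum.map (λ h j → h (β∈V j)) (λ h j → h (β∈V j)) dV)
            (inj₁ λ a∈U j → su a∈U (β∈V j) , sw a∈U (β∈V j)) ,
          decreasing⇒avoids G decG β β∈ α DV (λ j → DU (α∈U j))
            (λ b∈V j b≡α → U∩V=∅ (α∈U j) (≡.subst (List._∈ V) b≡α b∈V))
            (Sum.map (λ h j → h (α∈U j)) (λ h j → h (α∈U j)) dU)
            (inj₂ λ b∈V j → su (α∈U j) b∈V , sw (α∈U j) b∈V)
      }

  Sep-neg : ∀ {f A B} → Sep f A B → Sep (λ i → - f i) B A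
  Sep-neg s b∈B a∈A = neg-mono-≤ (s a∈A b∈B)

  increasing⇒decreasing-neg : ∀ {U k q u w} {F : Family U k q} → Increasing u w F →
                              Decreasing u (λ i → - w i) F
  increasing⇒decreasing-neg {u = u} {w} inc i≢j =
    Sum.map (λ (s , t) → (λ {a} {b} → s {a} {b}) , Sep-neg {w} t)
            (λ (s , t) → (λ {a} {b} → s {a} {b}) , Sep-neg {w} t) (inc i≢j)

  -- The mirror image of `decreasing-pair` under `flip-w`: the reflection exchanges increasing with
  -- decreasing both inside the clusters and between them.
  increasing-pair : ∀ {Dom} (c : Chart Dom) (nondeg : NonDegenerate) → let open Chart c in
    ∀ {U V k q} → (∀ {a} → a List.∈ U → Dom a) → (∀ {a} → a List.∈ V → Dom a) →
    (∀ {x} → x List.∈ U → ¬ (x List.∈ V)) → ConstSignOn d U → ConstSignOn d V →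
    Sep u U V → Sep w V U →
    (F : Family U k q) → Increasing u w F → (G : Family V k q) → Increasing u w G →
    AvoidingFamilies k q
  increasing-pair c nondeg DU DV U∩V=∅ dU dV su sw F incF G incG =
    decreasing-pair (flip-w c) nondeg DU DV U∩V=∅ (ConstSignOn-neg dU) (ConstSignOn-neg dV) su
      (Sep-neg {Chart.w c} sw)
      F (increasing⇒decreasing-neg {F = F} incF) G (increasing⇒decreasing-neg {F = G} incG)

-- Erdős-Szekeres for two transitive relations.

module _ {A : Set} {R : Rel A 0ℓ} where

  AllPairs-++⁻ : ∀ xs {ys} → AllPairs R (xs ++ ys) →
                 AllPairs R xs × AllPairs R ys × All (λ x → All (R x) ys) xs
  AllPairs-++⁻ []       rys      = [] , rys , []
  AllPairs-++⁻ (x ∷ xs) (r ∷ rs) with AllPairs-++⁻ xs rs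
  ... | rxs , rys , rxsys = All.++⁻ˡ xs r ∷ rxs , rys , All.++⁻ʳ xs r ∷ rxsys

  AllPairs-resp-⊆ : ∀ {xs ys} → xs ⊆ ys → AllPairs R ys → AllPairs R xs
  AllPairs-resp-⊆ []          []       = []
  AllPairs-resp-⊆ (y ∷ʳ xs⊆)  (_ ∷ rs) = AllPairs-resp-⊆ xs⊆ rs
  AllPairs-resp-⊆ (≡.refl ∷ xs⊆) (r ∷ rs) = All-resp-⊆ xs⊆ r ∷ AllPairs-resp-⊆ xs⊆ rs

  AllPairs-lookup : ∀ {xs} → AllPairs R xs → ∀ {i j} → i Fin.< j → R (lookup xs i) (lookup xs j)
  AllPairs-lookup {x ∷ xs} (r ∷ _)  {zero}  {suc j} _         = All.lookup r (∈-lookup j)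
  AllPairs-lookup {x ∷ xs} (_ ∷ rs) {suc i} {suc j} (s≤s i<j) = AllPairs-lookup rs i<j

-- Erdős–Szekeres, with the increasing subsequences grown one greedy
-- decreasing pile at a time.
module ErdősSzekeres {A : Set} {R S : Rel A 0ℓ} (S-trans : Transitive S) where

  -- An element given as `S`-related to the last one on the pile joins the pile. One given as
  -- `R`-related goes to `rest`, and the pile element that sent it there can be put in front of any
  -- subsequence of `rest` starting with it: this is `predecessor`.
  record Peeling (t : A) (xs : List A) : Set where
    field
      pile rest   : List A
      size        : length pile ℕ.+ length rest ≡ length xs
      pile⊆       : t ∷ pile ⊆ t ∷ xs
      pile-S      : AllPairs S (t ∷ pile)
      rest⊆       : rest ⊆ xs
      predecessor : ∀ {c cs} → c ∷ cs ⊆ rest → ∃[ y ] R y c × y ∷ c ∷ cs ⊆ t ∷ xs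

  peel : ∀ t xs → AllPairs (λ x y → R x y ⊎ S x y) (t ∷ xs) → Peeling t xs
  peel t [] _ = record
    { pile = [] ; rest = [] ; size = ≡.refl ; pile⊆ = ≡.refl ∷ [] ; pile-S = [] ∷ [] ; rest⊆ = []
    ; predecessor = λ () }
  peel t (z ∷ zs) ((inj₁ tRz ∷ tzs) ∷ zzs ∷ zs′) = record
    { pile = pile ; rest = z ∷ rest
    ; size = ≡.trans (ℕ.+-suc (length pile) (length rest)) (≡.cong suc size)
    ; pile⊆ = later pile⊆ ; pile-S = pile-S ; rest⊆ = ≡.refl ∷ rest⊆
    ; predecessor = λ
        { (.z ∷ʳ c⊆) → let y , yRc , y⊆ = predecessor c⊆ in y , yRc , later y⊆
        ; (≡.refl ∷ c⊆) → t , tRz , ≡.refl ∷ ≡.refl ∷ Sublist.⊆-trans c⊆ rest⊆ }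
    }
    where
    open Peeling (peel t zs (tzs ∷ zs′))
    later : ∀ {ys} → ys ⊆ t ∷ zs → ys ⊆ t ∷ z ∷ zs
    later (_ ∷ʳ ys⊆) = t ∷ʳ z ∷ʳ ys⊆
    later (eq ∷ ys⊆) = eq ∷ z ∷ʳ ys⊆
  peel t (z ∷ zs) ((inj₂ tSz ∷ _) ∷ zzs) = record
    { pile = z ∷ pile ; rest = rest ; size = ≡.cong suc size
    ; pile⊆ = ≡.refl ∷ pile⊆
    ; pile-S = (tSz ∷ All.map (S-trans tSz) (AllPairs.head pile-S)) ∷ pile-S
    ; rest⊆ = z ∷ʳ rest⊆
    ; predecessor = λ c⊆ → let y , yRc , y⊆ = predecessor c⊆ in y , yRc , t ∷ʳ y⊆
    }
    where open Peeling (peel z zs zzs)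

  Subsequence : Rel A 0ℓ → ℕ → List A → Set
  Subsequence T m xs = ∃[ ys ] ys ⊆ xs × length ys ≡ m × AllPairs T ys

  -- A pile of more than `b` elements is already the `S`-chain. Otherwise removing it costs at most
  -- `b` elements and pays for one more step of the `R`-chain.
  erdősSzekeres : Transitive R → ∀ a b xs → AllPairs (λ x y → R x y ⊎ S x y) xs →
    a ℕ.* b ℕ.< length xs → Subsequence R (suc a) xs ⊎ Subsequence S (suc b) xs
  erdősSzekeres R-trans zero b (x ∷ xs) _ _ =
    inj₁ (x ∷ [] , ≡.refl ∷ Sublist.minimum xs , ≡.refl , [] ∷ [])
  erdősSzekeres R-trans (suc a) b (t ∷ xs) pairs ab< with b ℕ.<? length (t ∷ Peeling.pile (peel t xs pairs))
  ... | yes b< = inj₂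
    ( take (suc b) (t ∷ pile) , Sublist.⊆-trans (take-⊆ (suc b) (t ∷ pile)) pile⊆
    , ≡.trans (List.length-take (suc b) (t ∷ pile)) (ℕ.m≤n⇒m⊓n≡m b<)
    , AllPairs.take⁺ (suc b) pile-S )
    where open Peeling (peel t xs pairs)
  ... | no b≮ with erdősSzekeres R-trans a b rest (AllPairs-resp-⊆ rest⊆ (AllPairs.tail pairs)) bound
    where
    open Peeling (peel t xs pairs)
    bound : a ℕ.* b ℕ.< length rest
    bound = ℕ.+-cancelˡ-< b _ _ (ℕ.<-≤-trans ab<
      (ℕ.≤-trans (ℕ.≤-reflexive (≡.cong suc (≡.sym size))) (ℕ.+-monoˡ-≤ (length rest) (ℕ.≮⇒≥ b≮))))
  ... | inj₂ (ys , ys⊆ , |ys| , S-ys) = inj₂ (ys , t ∷ʳ Sublist.⊆-trans ys⊆ (Peeling.rest⊆ (peel t xs pairs)) , |ys| , S-ys)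
  ... | inj₁ (c ∷ cs , c⊆ , |c| , c-R ∷ cs-R) with Peeling.predecessor (peel t xs pairs) c⊆
  ... | y , yRc , y⊆ = inj₁ (y ∷ c ∷ cs , y⊆ , ≡.cong suc |c| , (yRc ∷ All.map (R-trans yRc) c-R) ∷ c-R ∷ cs-R)

-- Splitting by a coordinate, and monotone families from a grid.

module Selection (ℝ : CompleteOrderedField) {n : ℕ} (p : Vector (Plane.Point ℝ) n) where
  open OrderedField ℝ using (Carrier; _≤_; ≤-refl; ≤-trans; ≤-total; decTotalOrder)
  open Configuration ℝ p

  Disjoint : Rel Indices 0ℓ
  Disjoint A B = ∀ {x} → x List.∈ A → ¬ (x List.∈ B)

  Within : Rel Indices 0ℓ
  Within A B = ∀ {x} → x List.∈ A → x List.∈ B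

  Disjoint-mono : ∀ {A A′ B B′} → Within A′ A → Within B′ B → Disjoint A B → Disjoint A′ B′
  Disjoint-mono s t d x∈A′ x∈B′ = d (s x∈A′) (t x∈B′)

  Sep-mono : ∀ f {A A′ B B′} → Within A′ A → Within B′ B → Sep f A B → Sep f A′ B′
  Sep-mono f s t sep a∈ b∈ = sep (s a∈) (t b∈)

  record Split (f : Fin n → Carrier) (xs : Indices) (q : ℕ) : Set where
    field
      lo hi    : Indices
      lo⊆      : Within lo xs
      hi⊆      : Within hi xs
      lo!      : Unique lo
      hi!      : Unique hi
      disjoint : Disjoint lo hi
      |lo|     : length lo ≡ q
      |hi|     : q ℕ.+ length hi ≡ length xs
      sep      : Sep f lo hi

  splitSorted : ∀ f xs q → Unique xs → q ℕ.≤ length xs → Split f xs q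
  splitSorted f xs q xs! q≤ = record
    { lo = take q s ; hi = drop q s
    ; lo⊆ = λ x∈ → Perm.∈-resp-↭ perm (∈-++⁺ˡ x∈)
    ; hi⊆ = λ x∈ → Perm.∈-resp-↭ perm (∈-++⁺ʳ (take q s) x∈)
    ; lo! = proj₁ unique-parts ; hi! = proj₁ (proj₂ unique-parts)
    ; disjoint = λ x∈lo x∈hi → All.lookup (All.lookup (proj₂ (proj₂ unique-parts)) x∈lo) x∈hi ≡.refl
    ; |lo| = |lo|
    ; |hi| = ≡.trans (≡.cong (ℕ._+ length (drop q s)) (≡.sym |lo|))
        (≡.trans (≡.sym (List.length-++ (take q s))) (Perm.↭-length perm))
    ; sep = λ a∈ b∈ → All.lookup (All.lookup (proj₂ (proj₂ sorted-parts)) a∈) b∈ }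
    where
    open Sort (On.decTotalOrder decTotalOrder f) using (sort; sort-↭; sort-↗)
    s = sort xs
    whole : take q s ++ drop q s ≡ s
    whole = List.take++drop≡id q s
    perm : take q s ++ drop q s ↭ xs
    perm = ≡.subst (_↭ xs) (≡.sym whole) (sort-↭ xs)
    unique-parts = AllPairs-++⁻ (take q s)
      (Permₛ.Unique-resp-↭ (≡.setoid (Fin n)) (↭⇒↭ₛ (↭-sym perm)) xs!)
    sorted-parts = AllPairs-++⁻ (take q s) (≡.subst (AllPairs (λ i j → f i ≤ f j)) (≡.sym whole)
      (Sorted.Sorted⇒AllPairs (DecTotalOrder.totalOrder (On.decTotalOrder decTotalOrder f)) (sort-↗ xs)))
    |lo| : length (take q s) ≡ q
    |lo| = ≡.trans (List.length-take q s)
      (ℕ.m≤n⇒m⊓n≡m (≡.subst (q ℕ.≤_) (≡.sym (Perm.↭-length (sort-↭ xs))) q≤))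

  abstract
    -- From here on only the fields of `Split` matter; the sorting behind them stays hidden.
    split : ∀ f xs q → Unique xs → q ℕ.≤ length xs → Split f xs q
    split = splitSorted

  record Blocks (f : Fin n → Carrier) (xs : Indices) (t q : ℕ) : Set where
    field
      block    : Fin t → Indices
      block⊆   : ∀ i → Within (block i) xs
      block!   : ∀ i → Unique (block i)
      |block|  : ∀ i → length (block i) ≡ q
      disjoint : ∀ {i j} → i Fin.< j → Disjoint (block i) (block j)
      sep      : ∀ {i j} → i Fin.< j → Sep f (block i) (block j)

  blocks : ∀ f xs t q → Unique xs → t ℕ.* q ℕ.≤ length xs → Blocks f xs t q
  blocks f xs zero q _ _ = record
    { block = λ () ; block⊆ = λ () ; block! = λ () ; |block| = λ ()
    ; disjoint = λ { {()} } ; sep = λ { {()} } }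
  blocks f xs (suc t) q xs! t*q≤ = record
    { block    = λ { zero → lo ; (suc i) → B.block i }
    ; block⊆   = λ { zero → lo⊆ ; (suc i) x∈ → hi⊆ (B.block⊆ i x∈) }
    ; block!   = λ { zero → lo! ; (suc i) → B.block! i }
    ; |block|  = λ { zero → |lo| ; (suc i) → B.|block| i }
    ; disjoint = λ { {zero} {suc j} _ x∈ y∈ → disjoint x∈ (B.block⊆ j y∈)
                   ; {suc i} {suc j} (s≤s i<j) → B.disjoint i<j }
    ; sep      = λ { {zero} {suc j} _ x∈ y∈ → sep x∈ (B.block⊆ j y∈)
                   ; {suc i} {suc j} (s≤s i<j) → B.sep i<j } }
    where
    open Split (split f xs q xs! (ℕ.≤-trans (ℕ.m≤m+n q (t ℕ.* q)) t*q≤))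
    module B = Blocks (blocks f hi t q hi!
      (ℕ.+-cancelˡ-≤ q _ _ (≡.subst (suc t ℕ.* q ℕ.≤_) (≡.sym |hi|) t*q≤)))

  maximal : ∀ (f : Fin n → Carrier) x xs → ∃[ m ] m List.∈ x ∷ xs × (∀ {y} → y List.∈ x ∷ xs → f y ≤ f m)
  maximal f x [] = x , here ≡.refl , λ { (here ≡.refl) → ≤-refl }
  maximal f x (y ∷ ys) with maximal f y ys
  ... | m , m∈ , max with ≤-total (f x) (f m)
  ... | inj₁ x≤m = m , there m∈ , λ { (here ≡.refl) → x≤m ; (there z∈) → max z∈ }
  ... | inj₂ m≤x = x , here ≡.refl , λ { (here ≡.refl) → ≤-refl ; (there z∈) → ≤-trans (max z∈) m≤x }

  minimum-first : ∀ {X : Set} (f : X → Carrier) x xs →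
    ∃₂ λ m rest → m ∷ rest ↭ x ∷ xs × All (λ y → f m ≤ f y) rest
  minimum-first f x [] = x , [] , Perm.refl , []
  minimum-first f x (y ∷ ys) with minimum-first f y ys
  ... | m , rest , perm , min with ≤-total (f x) (f m)
  ... | inj₁ x≤m = x , y ∷ ys , Perm.refl ,
    Perm.All-resp-↭ perm (x≤m ∷ All.map (≤-trans x≤m) min)
  ... | inj₂ m≤x = m , x ∷ rest , Perm.trans (Perm.swap m x Perm.refl) (Perm.prep x perm) , m≤x ∷ min

  module Grid (u w : Fin n → Carrier) (U : Indices) (q′ : ℕ) where
    q : ℕ
    q = suc q′

    -- `t` counts the cells still to be picked: the column survives that many removals of `q`
    -- points.
    record Column (t : ℕ) : Set where
      field
        members : Indices
        unique  : Unique members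
        ⊆U      : Within members U
        size    : t ℕ.* q ℕ.≤ length members

    open Column

    -- Made symmetric because the columns get reordered by their thresholds, which destroys their
    -- order in `u`.
    Apart : Rel Indices 0ℓ
    Apart A B = (Sep u A B ⊎ Sep u B A) × Disjoint A B

    Apart-sym : Symmetric Apart
    Apart-sym (s , d) = Sum.swap s , λ x∈ y∈ → d y∈ x∈

    Apart-mono : ∀ {A A′ B B′} → Within A′ A → Within B′ B → Apart A B → Apart A′ B′
    Apart-mono s t (inj₁ h , d) = inj₁ (Sep-mono u s t h) , Disjoint-mono s t d
    Apart-mono s t (inj₂ h , d) = inj₂ (Sep-mono u t s h) , Disjoint-mono s t d

    bottom : ∀ {t} → (c : Column (suc t)) → Split w (members c) q
    bottom {t} c = split w (members c) q (unique c) (ℕ.≤-trans (ℕ.m≤m+n q (t ℕ.* q)) (size c))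

    -- The largest `w` among the `q` lowest points, which exist as `q` is a successor. It is the
    -- level by which columns compete to give the next cell.
    threshold : ∀ {t} (c : Column (suc t)) →
      ∃[ v ] (∀ {x} → x List.∈ Split.lo (bottom c) → w x ≤ v) × (∀ {y} → y List.∈ Split.hi (bottom c) → v ≤ w y)
    threshold c with Split.lo (bottom c) | Split.|lo| (bottom c) | Split.sep (bottom c)
    ... | x ∷ xs | _ | sep with maximal w x xs
    ... | m , m∈ , max = w m , max , λ y∈ → sep m∈ y∈

    top : ∀ {t} → Column (suc t) → Column t
    top {t} c = record
      { members = hi ; unique = hi! ; ⊆U = λ x∈ → ⊆U c (hi⊆ x∈)
      ; size = ℕ.+-cancelˡ-≤ q _ _ (≡.subst (suc t ℕ.* q ℕ.≤_) (≡.sym |hi|) (size c)) }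
      where open Split (bottom c)

    bottom-cell : ∀ {t} → Column (suc t) → Column 1
    bottom-cell c = record
      { members = lo ; unique = lo! ; ⊆U = λ x∈ → ⊆U c (lo⊆ x∈)
      ; size = ℕ.≤-reflexive (≡.trans (ℕ.+-identityʳ q) (≡.sym |lo|)) }
      where open Split (bottom c)

    Above : Rel Indices 0ℓ
    Above A B = Sep w A B × Apart A B

    -- The next cell is the bottom of the column whose q lowest points end
    -- first; every other column then gives up its q lowest points.
    pick-cells : ∀ t (cs : List (Column t)) → length cs ≡ t → AllPairs (Apart on members) cs →
      Σ[ ys ∈ List (Column 1) ] length ys ≡ t × AllPairs (Above on members) ys ×
        All (λ y → Any (λ c → Within (members y) (members c)) cs) ys
    pick-cells zero cs _ _ = [] , ≡.refl , [] , []
    pick-cells (suc t) (c₀ ∷ cs₀) |cs| apart with minimum-first (proj₁ ∘ threshold) c₀ cs₀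
    ... | c , rest , perm , min
      with Permₛ.AllPairs-resp-↭ (≡.setoid _) Apart-sym ((λ { ≡.refl r → r }) , (λ { ≡.refl r → r }))
             (↭⇒↭ₛ (↭-sym perm)) apart
    ... | c-apart ∷ rest-apart
      with pick-cells t (map top rest)
             (≡.trans (List.length-map top rest) (ℕ.suc-injective (≡.trans (Perm.↭-length perm) |cs|)))
             (AllPairs.map⁺ (AllPairs.map
               (λ {a} {b} → Apart-mono (Split.hi⊆ (bottom a)) (Split.hi⊆ (bottom b))) rest-apart))
    ... | ys , |ys| , above , origin = bottom-cell c ∷ ys , ≡.cong suc |ys| ,
      All.map (λ {y} → first {y}) origin ∷ above ,
      Perm.Any-resp-↭ perm (here (Split.lo⊆ (bottom c))) ∷ All.map (λ {y} → later {y}) origin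
      where
      first : ∀ {y : Column 1} → Any (λ c′ → Within (members y) (members c′)) (map top rest) →
              Above (members (bottom-cell c)) (members y)
      first {y} any = All.lookupWith {Q = λ c′ → Within (members y) (members (top c′))} {R = λ _ → Above (members (bottom-cell c)) (members y)}
        (λ {c′} (v≤ , ap) y⊆ → lowest c′ v≤ ap y⊆) (All.zip (min , c-apart)) (Any.map⁻ any)
        where
        lowest : ∀ c′ → proj₁ (threshold c) ≤ proj₁ (threshold c′) → Apart (members c) (members c′) →
                 Within (members y) (members (top c′)) → Above (members (bottom-cell c)) (members y)
        lowest c′ v≤ ap y⊆ =
          (λ a∈ b∈ → ≤-trans (proj₁ (proj₂ (threshold c)) a∈)
            (≤-trans v≤ (proj₂ (proj₂ (threshold c′)) (y⊆ b∈)))) ,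
          Apart-mono (Split.lo⊆ (bottom c)) (λ x∈ → Split.hi⊆ (bottom c′) (y⊆ x∈)) ap
      later : ∀ {y : Column 1} → Any (λ c′ → Within (members y) (members c′)) (map top rest) →
              Any (λ c′ → Within (members y) (members c′)) (c₀ ∷ cs₀)
      later {y} any = Perm.Any-resp-↭ perm (there (Any.map
        {P = λ c′ → Within (members y) (members (top c′))} {Q = λ c′ → Within (members y) (members c′)}
        (λ {a} s x∈ → Split.hi⊆ (bottom a) (s x∈)) (Any.map⁻ any)))

    listFamily : ∀ k (ys : List (Column 1)) → length ys ≡ k → AllPairs (Disjoint on members) ys → Family U k q
    listFamily _ ys ≡.refl disj = record
      { cell     = cell′
      ; cell⊆    = λ i → ⊆U (lookup ys i)
      ; unique   = λ i → unique (lookup ys i)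
      ; size     = λ i → ℕ.≤-trans (ℕ.≤-reflexive (≡.sym (ℕ.*-identityˡ q))) (size (lookup ys i))
      ; disjoint = disjoint′
      }
      where
      cell′ : Fin (length ys) → Indices
      cell′ i = members (lookup ys i)
      disjoint′ : ∀ {i j} → i ≢ j → Disjoint (cell′ i) (cell′ j)
      disjoint′ {i} {j} i≢j x∈ x∈′ with Fin.<-cmp i j
      ... | tri< i<j _ _ = AllPairs-lookup disj i<j x∈ x∈′
      ... | tri≈ _ i≡j _ = i≢j i≡j
      ... | tri> _ _ j<i = AllPairs-lookup disj j<i x∈′ x∈

    private
      -- Both relations climb in `w`, the order in which the cells are picked, and differ in the
      -- direction of `u`.
      ↗ ↘ : Rel Indices 0ℓ
      ↗ A B = Sep u A B × Sep w A B
      ↘ A B = Sep u B A × Sep w A B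

    listFamily-increasing : ∀ k ys (|ys| : length ys ≡ k) (disj : AllPairs (Disjoint on members) ys) →
      AllPairs (↗ on members) ys → Increasing u w (listFamily k ys |ys| disj)
    listFamily-increasing _ ys ≡.refl disj inc {i} {j} i≢j with Fin.<-cmp i j
    ... | tri< i<j _ _ = inj₁ (AllPairs-lookup inc i<j)
    ... | tri≈ _ i≡j _ = contradiction i≡j i≢j
    ... | tri> _ _ j<i = inj₂ (AllPairs-lookup inc j<i)

    listFamily-decreasing : ∀ k ys (|ys| : length ys ≡ k) (disj : AllPairs (Disjoint on members) ys) →
      AllPairs (↘ on members) ys → Decreasing u w (listFamily k ys |ys| disj)
    listFamily-decreasing _ ys ≡.refl disj dec {i} {j} i≢j with Fin.<-cmp i j
    ... | tri< i<j _ _ = inj₂ (AllPairs-lookup dec i<j)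
    ... | tri≈ _ i≡j _ = contradiction i≡j i≢j
    ... | tri> _ _ j<i = inj₁ (AllPairs-lookup dec j<i)

    -- Transitivity of `Sep` needs a point in the middle set; a cell has one because `q` is
    -- positive.
    inhabited : (c : Column 1) → ∃[ x ] x List.∈ members c
    inhabited c with members c | size c
    ... | x ∷ _ | _ = x , here ≡.refl

    private
      Sep-trans : ∀ f (a b c : Column 1) → Sep f (members a) (members b) → Sep f (members b) (members c) →
                  Sep f (members a) (members c)
      Sep-trans f a b c s t x∈ z∈ = ≤-trans (s x∈ (proj₂ (inhabited b))) (t (proj₂ (inhabited b)) z∈)

      ↗-trans : Transitive (↗ on members)
      ↗-trans {a} {b} {c} (s , t) (s′ , t′) = Sep-trans u a b c s s′ , Sep-trans w a b c t t′

      ↘-trans : Transitive (↘ on members)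
      ↘-trans {a} {b} {c} (s , t) (s′ , t′) = Sep-trans u c b a s′ s , Sep-trans w a b c t t′

      direction : ∀ {A B} → Above A B → ↗ A B ⊎ ↘ A B
      direction (sw , inj₁ su , _) = inj₁ (su , sw)
      direction (sw , inj₂ su , _) = inj₂ (su , sw)

      Above⇒Disjoint : ∀ {A B} → Above A B → Disjoint A B
      Above⇒Disjoint (_ , _ , d) = d

    grid-cells : ∀ K → Blocks u U K (K ℕ.* q) →
      Σ[ ys ∈ List (Column 1) ] length ys ≡ K × AllPairs (Above on members) ys
    grid-cells K B with pick-cells K (tabulate column) (List.length-tabulate column)
        (AllPairs.tabulate⁺-< {f = column} λ {i} {j} i<j → inj₁ (sep i<j) , disjoint i<j)
      where
      open Blocks B
      column : Fin K → Column K
      column i = record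
        { members = block i ; unique = block! i ; ⊆U = block⊆ i
        ; size = ℕ.≤-reflexive (≡.sym (|block| i)) }
    ... | ys , |ys| , above , _ = ys , |ys| , above

    -- There are k² columns of k² q points, and each of them yields one cell of q points. Any two
    -- cells are separated in both coordinates, and k² exceeds (k - 1)², so Erdős-Szekeres leaves a
    -- monotone family of k cells.
    monotoneFamily : ∀ k′ → let k = suc k′ in Unique U → (k ℕ.* k) ℕ.* ((k ℕ.* k) ℕ.* q) ℕ.≤ length U →
      (Σ[ F ∈ Family U k q ] Increasing u w F) ⊎ (Σ[ F ∈ Family U k q ] Decreasing u w F)
    monotoneFamily k′ U! big with grid-cells (suc k′ ℕ.* suc k′) (blocks u U _ _ U! big)
    ... | ys , |ys| , above
      with ErdősSzekeres.erdősSzekeres {R = ↗ on members} {S = ↘ on members}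
        (λ {a} {b} {c} → ↘-trans {a} {b} {c}) (λ {a} {b} {c} → ↗-trans {a} {b} {c})
        k′ k′ ys
        (AllPairs.map (λ {a} {b} → direction {members a} {members b}) above)
        (≡.subst (k′ ℕ.* k′ ℕ.<_) (≡.sym |ys|)
          (s≤s (ℕ.≤-trans (ℕ.*-monoʳ-≤ k′ (ℕ.n≤1+n k′)) (ℕ.m≤n+m (k′ ℕ.* suc k′) k′))))
    ... | inj₁ (zs , zs⊆ , |zs| , inc) = inj₁ (listFamily (suc k′) zs |zs| disj , listFamily-increasing (suc k′) zs |zs| disj inc)
      where disj = AllPairs.map (λ {a} {b} → Above⇒Disjoint {members a} {members b}) (AllPairs-resp-⊆ zs⊆ above)
    ... | inj₂ (zs , zs⊆ , |zs| , dec) = inj₂ (listFamily (suc k′) zs |zs| disj , listFamily-decreasing (suc k′) zs |zs| disj dec)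
      where disj = AllPairs.map (λ {a} {b} → Above⇒Disjoint {members a} {members b}) (AllPairs-resp-⊆ zs⊆ above)

-- Monotone paths in 2-coloured triples.

length-filter-¬ : ∀ {A : Set} {P : Pred A 0ℓ} (P? : Decidable P) xs →
  length (filter P? xs) ℕ.+ length (filter (λ x → ¬? (P? x)) xs) ≡ length xs
length-filter-¬ P? [] = ≡.refl
length-filter-¬ P? (x ∷ xs) with P? x
... | yes _ = ≡.cong suc (length-filter-¬ P? xs)
... | no  _ = ≡.trans (ℕ.+-suc _ _) (≡.cong suc (length-filter-¬ P? xs))

-- The cups–caps argument of Erdős and Szekeres for monotone paths in an
-- arbitrary 2-colouring of triples.
module MonotonePaths {r : ℕ} (χ : Fin r → Fin r → Fin r → Bool) where

  -- `true` paths are recorded by their first edge and `false` paths by their last, so that a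
  -- `false` path arriving at a vertex can meet a `true` path leaving it.
  TrueFrom FalseTo : ℕ → Fin r → Fin r → Set
  TrueFrom zero    v w = ⊤
  TrueFrom (suc a) v w = ∃[ z ] w Fin.< z × χ v w z ≡ true × TrueFrom a w z
  FalseTo zero    u v = ⊤
  FalseTo (suc b) u v = ∃[ t ] t Fin.< u × χ t u v ≡ false × FalseTo b t u

  trueFrom? : ∀ a v w → Dec (TrueFrom a v w)
  trueFrom? zero    v w = yes tt
  trueFrom? (suc a) v w = Fin.any? λ z → (w Fin.<? z) ×-dec ((χ v w z Bool.≟ true) ×-dec trueFrom? a w z)

  EdgeIn : List (Fin r) → (Fin r → Fin r → Set) → Set
  EdgeIn V E = ∃[ v ] ∃[ w ] v List.∈ V × w List.∈ V × v Fin.< w × E v w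

  EdgeIn-mono : ∀ {V W E} → (∀ {x} → x List.∈ V → x List.∈ W) → EdgeIn V E → EdgeIn W E
  EdgeIn-mono s (v , w , v∈ , w∈ , v<w , e) = v , w , s v∈ , s w∈ , v<w , e

  -- Pascal's recursion with boundary value 2, so `bound a b` is twice the binomial coefficient of a
  -- + b over a. In particular `bound 3 3` is 40, the number of clusters in the end.
  bound : ℕ → ℕ → ℕ
  bound zero    b       = 2
  bound (suc a) zero    = 2
  bound (suc a) (suc b) = bound a (suc b) ℕ.+ bound (suc a) b

  trivialEdge : ∀ V → AllPairs Fin._<_ V → 2 ℕ.≤ length V → EdgeIn V (λ _ _ → ⊤)
  trivialEdge (v ∷ w ∷ _) ((v<w ∷ _) ∷ _) _ = v , w , here ≡.refl , there (here ≡.refl) , v<w , tt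
  trivialEdge (_ ∷ []) _ (ℕ.s≤s ())

  -- Let `T` consist of the vertices at which a `true` path counted by `a` starts. Inside its
  -- complement `C` no such path occurs. If a `false` path counted by `b` ends inside `T` with the
  -- edge `u v`, a `true` path continues from `v` to some `w`, and the colour of `u v w` lengthens
  -- one of the two.
  monotonePath : ∀ a b V → AllPairs Fin._<_ V → bound a b ℕ.≤ length V →
                 EdgeIn V (TrueFrom a) ⊎ EdgeIn V (FalseTo b)
  monotonePath zero    b       V V< big = inj₁ (trivialEdge V V< big)
  monotonePath (suc a) zero    V V< big = inj₂ (trivialEdge V V< big)
  monotonePath (suc a) (suc b) V V< big = cases
    where
    Extends : Pred (Fin r) 0ℓ
    Extends v = Any (λ w → v Fin.< w × TrueFrom a v w) V
    extends? : Decidable Extends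
    extends? v = Any.any? (λ w → (v Fin.<? w) ×-dec trueFrom? a v w) V
    T = filter extends? V
    C = filter (λ v → ¬? (extends? v)) V
    T⊆ : ∀ {x} → x List.∈ T → x List.∈ V
    T⊆ x∈ = proj₁ (∈-filter⁻ extends? {xs = V} x∈)
    C⊆ : ∀ {x} → x List.∈ C → x List.∈ V
    C⊆ x∈ = proj₁ (∈-filter⁻ (λ v → ¬? (extends? v)) {xs = V} x∈)

    inT : EdgeIn T (TrueFrom (suc a)) ⊎ EdgeIn T (FalseTo b) →
          EdgeIn V (TrueFrom (suc a)) ⊎ EdgeIn V (FalseTo (suc b))
    inT (inj₁ e) = inj₁ (EdgeIn-mono T⊆ e)
    inT (inj₂ (u , v , u∈ , v∈ , u<v , path))
      with List.find (proj₂ (∈-filter⁻ extends? {xs = V} v∈))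
    ... | w , w∈ , v<w , tail with χ u v w in eq
    ... | true  = inj₁ (u , v , T⊆ u∈ , T⊆ v∈ , u<v , w , v<w , eq , tail)
    ... | false = inj₂ (v , w , T⊆ v∈ , w∈ , v<w , u , u<v , eq , path)

    inC : EdgeIn C (TrueFrom a) ⊎ EdgeIn C (FalseTo (suc b)) →
          EdgeIn V (TrueFrom (suc a)) ⊎ EdgeIn V (FalseTo (suc b))
    inC (inj₁ (v , w , v∈ , w∈ , v<w , path)) = contradiction
      (List.lose (C⊆ w∈) (v<w , path)) (proj₂ (∈-filter⁻ (λ v → ¬? (extends? v)) {xs = V} v∈))
    inC (inj₂ e) = inj₂ (EdgeIn-mono C⊆ e)

    cases : EdgeIn V (TrueFrom (suc a)) ⊎ EdgeIn V (FalseTo (suc b))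
    cases with bound (suc a) b ℕ.≤? length T
    ... | yes T-big = inT (monotonePath (suc a) b T (AllPairs.filter⁺ extends? V<) T-big)
    ... | no  T-small = inC (monotonePath a (suc b) C (AllPairs.filter⁺ (λ v → ¬? (extends? v)) V<)
      (ℕ.+-cancelʳ-≤ (bound (suc a) b) _ _ (ℕ.≤-trans big
        (ℕ.≤-trans (ℕ.≤-reflexive (≡.sym (length-filter-¬ extends? V)))
          (ℕ.≤-trans (ℕ.+-monoˡ-≤ (length C) (ℕ.<⇒≤ (ℕ.≰⇒> T-small)))
            (ℕ.≤-reflexive (ℕ.+-comm (bound (suc a) b) (length C))))))))

  record MonochromaticPath : Set where
    field
      {i₁ i₂ i₃ i₄ i₅} : Fin r
      1<2 : i₁ Fin.< i₂
      2<3 : i₂ Fin.< i₃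
      3<4 : i₃ Fin.< i₄
      4<5 : i₄ Fin.< i₅
      colour : Bool
      123≡ : χ i₁ i₂ i₃ ≡ colour
      234≡ : χ i₂ i₃ i₄ ≡ colour
      345≡ : χ i₃ i₄ i₅ ≡ colour

  monochromaticPath : bound 3 3 ℕ.≤ r → MonochromaticPath
  monochromaticPath big with monotonePath 3 3 (allFin r) (AllPairs.tabulate⁺-< id)
    (≡.subst (bound 3 3 ℕ.≤_) (≡.sym (List.length-tabulate {n = r} id)) big)
  ... | inj₁ (_ , _ , _ , _ , p , _ , q , c , _ , q′ , c′ , _ , q″ , c″ , _) = record
    { 1<2 = p ; 2<3 = q ; 3<4 = q′ ; 4<5 = q″ ; 123≡ = c ; 234≡ = c′ ; 345≡ = c″ }
  ... | inj₂ (_ , _ , _ , _ , p , _ , q , c , _ , q′ , c′ , _ , q″ , c″ , _) = record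
    { 1<2 = q″ ; 2<3 = q′ ; 3<4 = q ; 4<5 = p ; 123≡ = c″ ; 234≡ = c′ ; 345≡ = c }

-- Halving lines and oriented triples of clusters.

module _ {A : Set} where

  Unique-⊆⇒length≤ : ∀ {xs ys : List A} → Unique xs → (∀ {x} → x List.∈ xs → x List.∈ ys) →
                     length xs ℕ.≤ length ys
  Unique-⊆⇒length≤ {[]}     _  _ = z≤n
  Unique-⊆⇒length≤ {x ∷ xs} (x∉ ∷ xs!) s with ∈-∃++ (s (here ≡.refl))
  ... | as , bs , ≡.refl = ℕ.≤-trans (s≤s (Unique-⊆⇒length≤ xs! s′)) (ℕ.≤-reflexive (≡.trans
      (≡.cong suc (List.length-++ as))
      (≡.trans (≡.sym (ℕ.+-suc (length as) (length bs))) (≡.sym (List.length-++ as)))))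
    where
    s′ : ∀ {y} → y List.∈ xs → y List.∈ as ++ bs
    s′ y∈ with ∈-++⁻ as (s (there y∈))
    ... | inj₁ y∈as         = ∈-++⁺ˡ y∈as
    ... | inj₂ (here ≡.refl)  = contradiction ≡.refl (All.lookup x∉ y∈)
    ... | inj₂ (there y∈bs) = ∈-++⁺ʳ as y∈bs

commonElement : ∀ {n} {xs ys zs : List (Fin n)} → Unique xs → Unique ys →
  (∀ {x} → x List.∈ xs → x List.∈ zs) → (∀ {x} → x List.∈ ys → x List.∈ zs) →
  length zs ℕ.< length xs ℕ.+ length ys → ∃[ x ] x List.∈ xs × x List.∈ ys
commonElement {xs = xs} {ys} {zs} xs! ys! s t big with Any.any? (λ x → _∈?_ Fin._≟_ x ys) xs
... | yes common = List.find common
... | no  apart  = contradiction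
  (≡.subst (ℕ._≤ length zs) (List.length-++ xs)
    (Unique-⊆⇒length≤ (Unique.++⁺ xs! ys! (λ (x∈ , y∈) → apart (List.lose x∈ y∈)))
      (λ x∈ → [ s , t ]′ (∈-++⁻ xs x∈))))
  (ℕ.<⇒≱ big)

module Triples (ℝ : CompleteOrderedField) {n : ℕ} (p : Vector (Plane.Point ℝ) n) where
  open OrderedField ℝ
  open Configuration ℝ p
  open Selection ℝ p

  record Part (A : Indices) (m : ℕ) : Set where
    field
      members : Indices
      ⊆whole  : Within members A
      unique  : Unique members
      size    : m ℕ.≤ length members

  open Part

  record Median (f : Fin n → Carrier) (xs : Indices) (q : ℕ) : Set where
    field
      γ       : Carrier
      lower   : Part xs (suc q)
      upper   : Part xs (suc q)
      lower≤γ : ∀ {i} → i List.∈ members lower → f i ≤ γ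
      γ≤upper : ∀ {i} → i List.∈ members upper → γ ≤ f i

  -- The median itself is put into both halves, so each has q + 1 of the 2q + 1 elements. Each half
  -- is then a majority, and two majorities of one set always meet.
  median : ∀ f xs q → Unique xs → length xs ≡ suc (q ℕ.+ q) → Median f xs q
  median f xs q xs! |xs| with split f xs (suc q) xs! (≡.subst (suc q ℕ.≤_) (≡.sym |xs|) (s≤s (ℕ.m≤m+n q q)))
  ... | record { lo = [] ; |lo| = () }
  ... | record { lo = x ∷ lo ; hi = hi ; lo⊆ = lo⊆ ; hi⊆ = hi⊆ ; lo! = lo! ; hi! = hi!
               ; disjoint = disjoint ; |lo| = |lo| ; |hi| = |hi| ; sep = sep } with maximal f x lo
  ... | m , m∈ , max = record
    { γ = f m
    ; lower = record { members = x ∷ lo ; ⊆whole = lo⊆ ; unique = lo! ; size = ℕ.≤-reflexive (≡.sym |lo|) }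
    ; upper = record
      { members = m ∷ hi
      ; ⊆whole = λ { (here ≡.refl) → lo⊆ m∈ ; (there y∈) → hi⊆ y∈ }
      ; unique = All.¬Any⇒All¬ hi (disjoint m∈) ∷ hi!
      ; size = s≤s (ℕ.≤-reflexive (ℕ.+-cancelˡ-≡ (suc q) _ _ (≡.sym (≡.trans |hi| |xs|)))) }
    ; lower≤γ = max
    ; γ≤upper = λ { (here ≡.refl) → ≤-refl ; (there y∈) → sep m∈ y∈ } }

  X Y : Fin n → Carrier
  X i = proj₁ (p i)
  Y i = proj₂ (p i)

  Before : Indices → Indices → Set
  Before A B = ∀ {a b} → a List.∈ A → b List.∈ B → X a < X b

  before⇒≢ : ∀ {i j} → X i < X j → i ≢ j
  before⇒≢ Xi<Xj ≡.refl = O.irrefl refl Xi<Xj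

  Cup Cap : Indices → Indices → Indices → Set
  Cup A B C = ∀ {a b c} → a List.∈ A → b List.∈ B → c List.∈ C → 0# < det a b c
  Cap A B C = ∀ {a b c} → a List.∈ A → b List.∈ B → c List.∈ C → det a b c < 0#

  Oriented : Indices → Indices → Indices → Set
  Oriented A B C = Cup A B C ⊎ Cap A B C

  slope : Fin n → Fin n → Carrier
  slope i j = (Y j - Y i) / (X j - X i)

  -- The shear that makes lines of slope `h` horizontal. It preserves orientation, whence
  -- `det-height`.
  height : Carrier → Fin n → Carrier
  height h i = Y i - h * X i

  det-height : ∀ h a b c → det a b c ≈
    (X b - X a) * (height h c - height h b) - (X c - X b) * (height h b - height h a)
  det-height h a b c = solve 7 (λ h x₁ y₁ x₂ y₂ x₃ y₃ →
      (x₂ :- x₁) :* (y₃ :- y₁) :- (x₃ :- x₁) :* (y₂ :- y₁)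
      := (x₂ :- x₁) :* ((y₃ :- h :* x₃) :- (y₂ :- h :* x₂))
         :- (x₃ :- x₂) :* ((y₂ :- h :* x₂) :- (y₁ :- h :* x₁)))
    refl h (X a) (Y a) (X b) (Y b) (X c) (Y c)

  height-diff : ∀ h a c → (Y c - Y a) - (X c - X a) * h ≈ height h c - height h a
  height-diff h a c = solve 5 (λ h x₁ y₁ x₂ y₂ →
      (y₂ :- y₁) :- (x₂ :- x₁) :* h := (y₂ :- h :* x₂) :- (y₁ :- h :* x₁))
    refl h (X a) (Y a) (X c) (Y c)

  slope≤⇒height≥ : ∀ {h a c} → X a < X c → slope a c ≤ h → height h c ≤ height h a
  slope≤⇒height≥ {h} {a} {c} Xa<Xc s≤h = 0≤y-x⇒x≤y (≤-resp refl
    (trans (-‿cong (height-diff h a c))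
      (solve 2 (λ x y → :- (x :- y) := y :- x) refl (height h c) (height h a)))
    (neg-nonpos (x≤y⇒x-y≤0 (/-≤⇒ (x<y⇒0<y-x Xa<Xc) s≤h))))

  slope≥⇒height≤ : ∀ {h a c} → X a < X c → h ≤ slope a c → height h a ≤ height h c
  slope≥⇒height≤ {h} {a} {c} Xa<Xc h≤s = 0≤y-x⇒x≤y (≤-resp refl
    (height-diff h a c) (x≤y⇒0≤y-x (≤-/⇒ (x<y⇒0<y-x Xa<Xc) h≤s)))

  module _ (nondeg : NonDegenerate) where

    -- A line halving both A and C leaves a majority of B on one side.
    module HalvingLine {A B C} (q : ℕ) (A! : Unique A) (B! : Unique B) (C! : Unique C)
      (|A| : length A ≡ suc (q ℕ.+ q)) (|B| : length B ≡ suc (q ℕ.+ q)) (|C| : length C ≡ suc (q ℕ.+ q))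
      (AB : Before A B) (BC : Before B C) (AC : Before A C) where

      slopes : ∀ a → Median (slope a) C q
      slopes a = median (slope a) C q C! |C|

      MA : Median (λ a → Median.γ (slopes a)) A q
      MA = median (λ a → Median.γ (slopes a)) A q A! |A|

      -- A ham-sandwich slope for `A` and `C`: the median over `A` of the median slopes towards `C`.
      -- The line of this slope that halves `C` then halves `A` as well.
      h : Carrier
      h = Median.γ MA

      MB : Median (height h) B q
      MB = median (height h) B q B! |B|

      MC : Median (height h) C q
      MC = median (height h) C q C! |C|

      t : Carrier
      t = Median.γ MC

      majorities : ∀ (P Q : Part C (suc q)) → ∃[ c ] c List.∈ members P × c List.∈ members Q
      majorities P Q = commonElement (unique P) (unique Q) (⊆whole P) (⊆whole Q)
        (ℕ.≤-trans (ℕ.≤-reflexive (≡.cong suc (≡.trans |C| (≡.sym (ℕ.+-suc q q)))))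
          (ℕ.+-mono-≤ (size P) (size Q)))

      -- A majority of `C` is seen from `a` under slope at most `h`, so is not higher than `a` after
      -- the shear, and a majority of `C` has height at least `t`. A point in both majorities links
      -- `t` to `a`.
      lowerA-high : ∀ {a} → a List.∈ members (Median.lower MA) → t ≤ height h a
      lowerA-high {a} a∈ with majorities (Median.lower (slopes a)) (Median.upper MC)
      ... | c , c∈ , c∈′ = ≤-trans (Median.γ≤upper MC c∈′)
        (slope≤⇒height≥ (AC (⊆whole (Median.lower MA) a∈) (⊆whole (Median.upper MC) c∈′))
          (≤-trans (Median.lower≤γ (slopes a) c∈) (Median.lower≤γ MA a∈)))

      upperA-low : ∀ {a} → a List.∈ members (Median.upper MA) → height h a ≤ t
      upperA-low {a} a∈ with majorities (Median.upper (slopes a)) (Median.lower MC)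
      ... | c , c∈ , c∈′ = ≤-trans
        (slope≥⇒height≤ (AC (⊆whole (Median.upper MA) a∈) (⊆whole (Median.lower MC) c∈′))
          (≤-trans (Median.γ≤upper MA a∈) (Median.γ≤upper (slopes a) c∈)))
        (Median.lower≤γ MC c∈′)

      det≉0 : ∀ {a b c} → a List.∈ A → b List.∈ B → c List.∈ C → ¬ (det a b c ≈ 0#)
      det≉0 a∈ b∈ c∈ = nondeg (before⇒≢ (AB a∈ b∈)) (before⇒≢ (AC a∈ c∈)) (before⇒≢ (BC b∈ c∈))

      below⇒cup : ∀ {a b c} → a List.∈ A → b List.∈ B → c List.∈ C →
                  t ≤ height h a → height h b ≤ t → t ≤ height h c → 0# < det a b c
      below⇒cup {a} {b} {c} a∈ b∈ c∈ ha hb hc = ≤∧≉⇒<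
        (≤-resp refl (sym (det-height h a b c)) (+-nonneg
          (*-nonneg (x≤y⇒0≤y-x (inj₁ (AB a∈ b∈))) (x≤y⇒0≤y-x (≤-trans hb hc)))
          (neg-nonpos (*-nonneg-nonpos (x≤y⇒0≤y-x (inj₁ (BC b∈ c∈))) (x≤y⇒x-y≤0 (≤-trans hb ha))))))
        (det≉0 a∈ b∈ c∈ ∘ sym)

      above⇒cap : ∀ {a b c} → a List.∈ A → b List.∈ B → c List.∈ C →
                  height h a ≤ t → t ≤ height h b → height h c ≤ t → det a b c < 0#
      above⇒cap {a} {b} {c} a∈ b∈ c∈ ha hb hc = ≤∧≉⇒<
        (≤-resp (sym (det-height h a b c)) refl (x≤y⇒x-y≤0 (≤-trans
          (*-nonneg-nonpos (x≤y⇒0≤y-x (inj₁ (AB a∈ b∈))) (x≤y⇒x-y≤0 (≤-trans hc hb)))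
          (*-nonneg (x≤y⇒0≤y-x (inj₁ (BC b∈ c∈))) (x≤y⇒0≤y-x (≤-trans ha hb))))))
        (det≉0 a∈ b∈ c∈)

      oriented : Σ[ A′ ∈ Part A (suc q) ] Σ[ B′ ∈ Part B (suc q) ] Σ[ C′ ∈ Part C (suc q) ]
        Oriented (members A′) (members B′) (members C′)
      oriented with ≤-total (Median.γ MB) t
      -- The half of `B` below the line goes with the halves of `A` and `C` above it, and `B` lies
      -- between them in abscissa: a cup. The other case is the reflected one.
      ... | inj₁ γB≤t = Median.lower MA , Median.lower MB , Median.upper MC , inj₁ λ a∈ b∈ c∈ →
        below⇒cup (⊆whole (Median.lower MA) a∈) (⊆whole (Median.lower MB) b∈) (⊆whole (Median.upper MC) c∈)
          (lowerA-high a∈) (≤-trans (Median.lower≤γ MB b∈) γB≤t) (Median.γ≤upper MC c∈)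
      ... | inj₂ t≤γB = Median.upper MA , Median.upper MB , Median.lower MC , inj₂ λ a∈ b∈ c∈ →
        above⇒cap (⊆whole (Median.upper MA) a∈) (⊆whole (Median.upper MB) b∈) (⊆whole (Median.lower MC) c∈)
          (upperA-low a∈) (≤-trans t≤γB (Median.γ≤upper MB b∈)) (Median.lower≤γ MC c∈)

    Part-trans : ∀ {A m k} (P : Part A m) → Part (members P) k → Part A k
    Part-trans P Q = record
      { members = members Q ; ⊆whole = ⊆whole P ∘ ⊆whole Q ; unique = unique Q ; size = size Q }

    trim : ∀ {A} m → Unique A → m ℕ.≤ length A → Σ[ P ∈ Part A m ] length (members P) ≡ m
    trim {A} m A! m≤ = record { members = lo ; ⊆whole = lo⊆ ; unique = lo! ; size = ℕ.≤-reflexive (≡.sym |lo|) } , |lo|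
      where open Split (split (λ _ → 0#) A m A! m≤)

    orientTriple : ∀ {A B C} m .{{_ : ℕ.NonZero m}} → Unique A → Unique B → Unique C →
      m ℕ.+ m ℕ.≤ length A → m ℕ.+ m ℕ.≤ length B → m ℕ.+ m ℕ.≤ length C →
      Before A B → Before B C → Before A C →
      Σ[ A′ ∈ Part A m ] Σ[ B′ ∈ Part B m ] Σ[ C′ ∈ Part C m ]
        Oriented (members A′) (members B′) (members C′)
    orientTriple {A} {B} {C} (suc q) A! B! C! A≥ B≥ C≥ AB BC AC =
      Part-trans PA A′ , Part-trans PB B′ , Part-trans PC C′ , o
      where
      -- Of 2m points 2m - 1 are kept: medians want an odd number, and their halves then have
      -- exactly m points.
      odd : ∀ {D} → suc q ℕ.+ suc q ℕ.≤ length D → suc (q ℕ.+ q) ℕ.≤ length D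
      odd = ℕ.≤-trans (s≤s (ℕ.+-monoʳ-≤ q (ℕ.n≤1+n q)))
      TA = trim (suc (q ℕ.+ q)) A! (odd {A} A≥)
      TB = trim (suc (q ℕ.+ q)) B! (odd {B} B≥)
      TC = trim (suc (q ℕ.+ q)) C! (odd {C} C≥)
      PA = proj₁ TA
      PB = proj₁ TB
      PC = proj₁ TC
      result = HalvingLine.oriented q (unique PA) (unique PB) (unique PC) (proj₂ TA) (proj₂ TB) (proj₂ TC)
        (λ a∈ b∈ → AB (⊆whole PA a∈) (⊆whole PB b∈))
        (λ b∈ c∈ → BC (⊆whole PB b∈) (⊆whole PC c∈))
        (λ a∈ c∈ → AC (⊆whole PA a∈) (⊆whole PC c∈))
      A′ = proj₁ result
      B′ = proj₁ (proj₂ result)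
      C′ = proj₁ (proj₂ (proj₂ result))
      o  = proj₂ (proj₂ (proj₂ result))

    Oriented-mono : ∀ {A A′ B B′ C C′} → Within A′ A → Within B′ B → Within C′ C →
                    Oriented A B C → Oriented A′ B′ C′
    Oriented-mono s t u (inj₁ cup) = inj₁ λ a∈ b∈ c∈ → cup (s a∈) (t b∈) (u c∈)
    Oriented-mono s t u (inj₂ cap) = inj₂ λ a∈ b∈ c∈ → cap (s a∈) (t b∈) (u c∈)

    -- Vacuous on triples that are not increasing, so that the full list of triples can be processed
    -- uniformly.
    OrientedAt : ∀ {r} → (Fin r → Indices) → Fin r × Fin r × Fin r → Set
    OrientedAt Z (i , j , l) = i Fin.< j → j Fin.< l → Oriented (Z i) (Z j) (Z l)

    module _ {r : ℕ} where

      orientAt : ∀ m .{{_ : ℕ.NonZero m}} (Z : Fin r → Indices) → (∀ i → Unique (Z i)) →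
        (∀ i → m ℕ.+ m ℕ.≤ length (Z i)) → (∀ {i j} → i Fin.< j → Before (Z i) (Z j)) →
        ∀ t → Σ[ P ∈ (∀ i → Part (Z i) m) ] OrientedAt (members ∘ P) t
      orientAt m Z Z! big before (i , j , l) with i Fin.<? j | j Fin.<? l
      ... | no i≮j | _ = (λ a → part a) , λ i<j → contradiction i<j i≮j
        where
        part : ∀ a → Part (Z a) m
        part a = proj₁ (trim m (Z! a) (ℕ.≤-trans (ℕ.m≤m+n m m) (big a)))
      ... | yes _ | no j≮l = (λ a → part a) , λ _ j<l → contradiction j<l j≮l
        where
        part : ∀ a → Part (Z a) m
        part a = proj₁ (trim m (Z! a) (ℕ.≤-trans (ℕ.m≤m+n m m) (big a)))
      ... | yes i<j | yes j<l
        with orientTriple m (Z! i) (Z! j) (Z! l) (big i) (big j) (big l)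
               (before i<j) (before j<l) (before (Fin.<-trans i<j j<l))
      ... | A′ , B′ , C′ , o = part , λ _ _ → Oriented-mono
          (at-i (i Fin.≟ i) (i Fin.≟ j) (i Fin.≟ l))
          (at-j (j Fin.≟ i) (j Fin.≟ j) (j Fin.≟ l))
          (at-l (l Fin.≟ i) (l Fin.≟ j) (l Fin.≟ l)) o
        where
        -- The decisions are arguments, so that the three inclusions below can be proved by cases on
        -- them. Which match takes precedence is harmless, as `i`, `j`, `l` are distinct.
        choose : ∀ {a} → Dec (a ≡ i) → Dec (a ≡ j) → Dec (a ≡ l) → Part (Z a) m
        choose (yes ≡.refl) _ _ = A′
        choose (no _) (yes ≡.refl) _ = B′
        choose (no _) (no _) (yes ≡.refl) = C′
        choose {a} (no _) (no _) (no _) = proj₁ (trim m (Z! a) (ℕ.≤-trans (ℕ.m≤m+n m m) (big a)))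
        part : ∀ a → Part (Z a) m
        part a = choose (a Fin.≟ i) (a Fin.≟ j) (a Fin.≟ l)
        at-i : ∀ d e f → Within (members (choose {i} d e f)) (members A′)
        at-i (yes ≡.refl) _ _ x∈ = x∈
        at-i (no i≢i)   _ _ _  = contradiction ≡.refl i≢i
        at-j : ∀ d e f → Within (members (choose {j} d e f)) (members B′)
        at-j (yes j≡i) _ _ _ = contradiction (≡.sym j≡i) (Fin.<⇒≢ i<j)
        at-j (no _) (yes ≡.refl) _ x∈ = x∈
        at-j (no _) (no j≢j)   _ _  = contradiction ≡.refl j≢j
        at-l : ∀ d e f → Within (members (choose {l} d e f)) (members C′)
        at-l (yes l≡i) _ _ _ = contradiction (≡.sym l≡i) (Fin.<⇒≢ (Fin.<-trans i<j j<l))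
        at-l (no _) (yes l≡j) _ _ = contradiction (≡.sym l≡j) (Fin.<⇒≢ j<l)
        at-l (no _) (no _) (yes ≡.refl) x∈ = x∈
        at-l (no _) (no _) (no l≢l)   _  = contradiction ≡.refl l≢l

      -- Orientation is inherited by subclusters, so a triple once treated stays oriented while
      -- later ones shrink the clusters further.
      orientAll : ∀ m .{{_ : ℕ.NonZero m}} ts (Z : Fin r → Indices) → (∀ i → Unique (Z i)) →
        (∀ i → 2 ℕ.^ length ts ℕ.* m ℕ.≤ length (Z i)) → (∀ {i j} → i Fin.< j → Before (Z i) (Z j)) →
        Σ[ P ∈ (∀ i → Part (Z i) m) ] All (OrientedAt (members ∘ P)) ts
      orientAll m [] Z Z! big before =
        (λ i → record { members = Z i ; ⊆whole = λ x∈ → x∈ ; unique = Z! i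
                      ; size = ℕ.≤-trans (ℕ.≤-reflexive (≡.sym (ℕ.*-identityˡ m))) (big i) }) , []
      orientAll m (t@(i , j , l) ∷ ts) Z Z! big before
        with orientAt (2 ℕ.^ length ts ℕ.* m) {{ℕ.m*n≢0 (2 ℕ.^ length ts) m {{ℕ.m^n≢0 2 (length ts)}}}} Z Z!
               (λ i → ℕ.≤-trans (ℕ.≤-reflexive (double (2 ℕ.^ length ts))) (big i)) before t
        where
        double : ∀ e → e ℕ.* m ℕ.+ e ℕ.* m ≡ (2 ℕ.* e) ℕ.* m
        double e = ≡.trans (≡.sym (ℕ.*-distribʳ-+ m e e)) (≡.cong (λ x → (e ℕ.+ x) ℕ.* m) (≡.sym (ℕ.+-identityʳ e)))
      ... | P , o with orientAll m ts (members ∘ P) (unique ∘ P) (size ∘ P)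
             (λ {i} {j} i<j a∈ b∈ → before i<j (⊆whole (P i) a∈) (⊆whole (P j) b∈))
      ... | Q , os = (λ i → Part-trans (P i) (Q i)) ,
        (λ i<j j<l → Oriented-mono (⊆whole (Q i)) (⊆whole (Q j)) (⊆whole (Q l)) (o i<j j<l)) ∷ os

-- The pattern 2143 in the pencil of lines through a point.

module Pencil (ℝ : CompleteOrderedField) {n : ℕ} (p : Vector (Plane.Point ℝ) n) where
  open OrderedField ℝ
  open Orientation ℝ using (cross)
  open Configuration ℝ p
  open Selection ℝ p
  open Triples ℝ p

  -- The clusters are numbered by increasing `w`. In the order of `u` they read `W 1F`, `W 0F`,
  -- `W 3F`, `W 2F`, which gives the pattern its name.
  record Pattern2143 {Dom : Fin n → Set} (c : Chart Dom) (W : Fin 4 → Indices) : Set where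
    open Chart c
    field
      dom      : ∀ i {x} → x List.∈ W i → Dom x
      sign     : ∀ i → ConstSignOn d (W i)
      disjoint : ∀ {i j} → i Fin.< j → Disjoint (W i) (W j)
      u-left   : Sep u (W 1F) (W 0F)
      u-right  : Sep u (W 3F) (W 2F)
      u-across : ∀ (i j : Fin 2) → Sep u (W (i Fin.↑ˡ 2)) (W (2 Fin.↑ʳ j))
      w-up     : ∀ {i j} → i Fin.< j → Sep w (W i) (W j)

  pattern⇒families : ∀ {Dom} {c : Chart Dom} {W} → NonDegenerate → Pattern2143 c W → ∀ k′ q′ →
    let k = suc k′ ; q = suc q′ in
    (∀ i → Unique (W i)) → (∀ i → (k ℕ.* k) ℕ.* ((k ℕ.* k) ℕ.* q) ℕ.≤ length (W i)) → AvoidingFamilies k q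
  pattern⇒families {Dom} {c} {W} nondeg P k′ q′ W! big = cases (family 0F) (family 1F) (family 2F) (family 3F)
    where
    open Chart c
    open Pattern2143 P
    k = suc k′
    q = suc q′
    Up Down : Fin 4 → Set
    Up i = Σ[ F ∈ Family (W i) k q ] Increasing u w F
    Down i = Σ[ F ∈ Family (W i) k q ] Decreasing u w F
    family : ∀ i → Up i ⊎ Down i
    family i = Grid.monotoneFamily u w (W i) q′ k′ (W! i) (big i)
    reversed : ∀ {i j} → i Fin.< j → Sep u (W j) (W i) → Up i → Up j → AvoidingFamilies k q
    reversed {i} {j} i<j su (F , incF) (G , incG) = increasing-pair c nondeg (dom j) (dom i)
      (λ x∈ y∈ → disjoint i<j y∈ x∈) (sign j) (sign i) su (w-up i<j) G incG F incF
    across : ∀ (i j : Fin 2) → Down (i Fin.↑ˡ 2) → Down (2 Fin.↑ʳ j) → AvoidingFamilies k q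
    across i j (F , decF) (G , decG) = decreasing-pair c nondeg (dom _) (dom _)
      (disjoint i<j) (sign _) (sign _) (u-across i j) (w-up i<j) F decF G decG
      where
      i<j : i Fin.↑ˡ 2 Fin.< 2 Fin.↑ʳ j
      i<j = ℕ.≤-trans (s≤s (ℕ.≤-reflexive (Fin.toℕ-↑ˡ i 2)))
        (ℕ.≤-trans (Fin.toℕ<n i) (ℕ.≤-trans (ℕ.m≤m+n 2 (Fin.toℕ j)) (ℕ.≤-reflexive (≡.sym (Fin.toℕ-↑ʳ 2 j)))))
    cases : Up 0F ⊎ Down 0F → Up 1F ⊎ Down 1F → Up 2F ⊎ Down 2F → Up 3F ⊎ Down 3F → AvoidingFamilies k q
    cases (inj₁ F) (inj₁ G) _        _        = reversed {0F} {1F} (s≤s z≤n) u-left F G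
    cases _        _        (inj₁ F) (inj₁ G) = reversed {2F} {3F} (s≤s (s≤s (s≤s z≤n))) u-right F G
    cases (inj₂ F) _        (inj₂ G) _        = across 0F 0F F G
    cases (inj₂ F) _        _        (inj₂ G) = across 0F 1F F G
    cases _        (inj₂ F) (inj₂ G) _        = across 1F 0F F G
    cases _        (inj₂ F) _        (inj₂ G) = across 1F 1F F G

  module _ (b : Fin n) where
    dx dy u w : Fin n → Carrier
    dx i = X i - X b
    dy i = Y i - Y b
    u i = dx i ⁻¹
    w i = dy i * u i

    OffVertical : Fin n → Set
    OffVertical i = ¬ (dx i ≈ 0#)

    w*dx≈dy : ∀ {i} → OffVertical i → w i * dx i ≈ dy i
    w*dx≈dy {i} off = trans (*-assoc (dy i) (u i) (dx i))
      (trans (*-congˡ (trans (*-comm (u i) (dx i)) (⁻¹-inverse (dx i) off))) (*-identityʳ (dy i)))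

    -- The projective map (x , y) ↦ (1 / x , y / x), with b moved to the origin.
    pencilChart : Chart OffVertical
    pencilChart = record { u = u ; w = w ; d = λ i → - dx i ; det≈ = λ {i} {j} {l} oi oj ol → sym (begin
      - dx i * - dx j * - dx l * cross (u j - u i) (w j - w i) (u l - u i) (w l - w i)
        ≈⟨ solve 9 (λ ei ej el ui uj ul wi wj wl →
             :- ei :* :- ej :* :- el :* ((uj :- ui) :* (wl :- wi) :- (ul :- ui) :* (wj :- wi))
             := :- ((ej :* uj) :* (wl :* el :* ei :- wi :* ei :* el)
                   :+ (ei :* ui) :* (wj :* ej :* el :- wl :* el :* ej)
                   :+ (el :* ul) :* (wi :* ei :* ej :- wj :* ej :* ei)))
             refl (dx i) (dx j) (dx l) (u i) (u j) (u l) (w i) (w j) (w l) ⟩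
      - ((dx j * u j) * (w l * dx l * dx i - w i * dx i * dx l)
        + (dx i * u i) * (w j * dx j * dx l - w l * dx l * dx j)
        + (dx l * u l) * (w i * dx i * dx j - w j * dx j * dx i))
        ≈⟨ -‿cong (+-cong (+-cong
             (*-cong (⁻¹-inverse _ oj) (diff (w*dx≈dy ol) (w*dx≈dy oi)))
             (*-cong (⁻¹-inverse _ oi) (diff (w*dx≈dy oj) (w*dx≈dy ol))))
             (*-cong (⁻¹-inverse _ ol) (diff (w*dx≈dy oi) (w*dx≈dy oj)))) ⟩
      - (1# * (dy l * dx i - dy i * dx l) + 1# * (dy j * dx l - dy l * dx j) + 1# * (dy i * dx j - dy j * dx i))
        ≈⟨ -‿cong (+-cong (+-cong (*-identityˡ _) (*-identityˡ _)) (*-identityˡ _)) ⟩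
      - ((dy l * dx i - dy i * dx l) + (dy j * dx l - dy l * dx j) + (dy i * dx j - dy j * dx i))
        ≈⟨ solve 8 (λ xi yi xj yj xl yl xb yb →
             :- (((yl :- yb) :* (xi :- xb) :- (yi :- yb) :* (xl :- xb))
               :+ ((yj :- yb) :* (xl :- xb) :- (yl :- yb) :* (xj :- xb))
               :+ ((yi :- yb) :* (xj :- xb) :- (yj :- yb) :* (xi :- xb)))
             := (xj :- xi) :* (yl :- yi) :- (xl :- xi) :* (yj :- yi))
             refl (X i) (Y i) (X j) (Y j) (X l) (Y l) (X b) (Y b) ⟩
      det i j l ∎) }
      where
      open SetoidReasoning setoid
      diff : ∀ {x x′ y y′ z t} → x ≈ x′ → y ≈ y′ → x * z - y * t ≈ x′ * z - y′ * t
      diff h k = +-cong (*-congʳ h) (-‿cong (*-congʳ k))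

    -- Lines through `b` become horizontal: `w` is the slope of the line from `b`. Orientation with
    -- `b` therefore compares slopes, up to the sides of the vertical through `b` on which the
    -- points lie.
    det-pencil : ∀ {i j} → OffVertical i → OffVertical j → det b i j ≈ dx i * dx j * (w j - w i)
    det-pencil {i} {j} oi oj = begin
      dx i * dy j - dx j * dy i
        ≈⟨ +-cong (*-congˡ (sym (w*dx≈dy oj))) (-‿cong (*-congˡ (sym (w*dx≈dy oi)))) ⟩
      dx i * (w j * dx j) - dx j * (w i * dx i)
        ≈⟨ solve 4 (λ ei ej wi wj → ei :* (wj :* ej) :- ej :* (wi :* ei) := ei :* ej :* (wj :- wi))
             refl (dx i) (dx j) (w i) (w j) ⟩
      dx i * dx j * (w j - w i) ∎
      where open SetoidReasoning setoid

    *-cancel-nonneg : ∀ {z v} → 0# ≤ z → 0# < z * v → 0# ≤ v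
    *-cancel-nonneg {z} {v} 0≤z 0<zv with ≤-total 0# v
    ... | inj₁ 0≤v = 0≤v
    ... | inj₂ v≤0 = contradiction 0<zv (≤⇒≯ (*-nonneg-nonpos 0≤z v≤0))

    left⇒dx<0 : ∀ {i} → X i < X b → dx i < 0#
    left⇒dx<0 {i} h = <-resp refl (-‿inverseʳ (X b)) (+-monoˡ-< (- X b) h)

    right⇒0<dx : ∀ {i} → X b < X i → 0# < dx i
    right⇒0<dx = x<y⇒0<y-x

    u-pos : ∀ {i} → X b < X i → 0# ≤ u i
    u-pos h = inj₁ (⁻¹-pos (right⇒0<dx h))

    left⇒off : ∀ {i} → X i < X b → OffVertical i
    left⇒off h dx≈0 = O.irrefl dx≈0 (left⇒dx<0 h)

    right⇒off : ∀ {i} → X b < X i → OffVertical i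
    right⇒off h dx≈0 = O.irrefl (sym dx≈0) (right⇒0<dx h)

    u-neg : ∀ {i} → X i < X b → u i ≤ 0#
    u-neg {i} h with ≤-total (u i) 0#
    ... | inj₁ u≤0 = u≤0
    ... | inj₂ 0≤u = contradiction 0<1 (≤⇒≯
      (≤-resp (⁻¹-inverse (dx i) (left⇒off h)) refl (*-nonpos-nonneg (inj₁ (left⇒dx<0 h)) 0≤u)))

    -- The reciprocal is decreasing on either side of `b`, though not across it; the sign hypothesis
    -- keeps both points on one side. This produces the two descents of 2143.
    u-antitone : ∀ {i j} → OffVertical i → OffVertical j → 0# ≤ u i * u j → X i < X j → u j ≤ u i
    u-antitone {i} {j} oi oj 0≤uu Xi<Xj = 0≤y-x⇒x≤y (≤-resp refl (begin
      u i * u j * (X j - X i)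
        ≈⟨ solve 5 (λ ui uj xi xj xb → ui :* uj :* (xj :- xi)
             := ui :* ((xj :- xb) :* uj) :- uj :* ((xi :- xb) :* ui)) refl (u i) (u j) (X i) (X j) (X b) ⟩
      u i * (dx j * u j) - u j * (dx i * u i)
        ≈⟨ +-cong (trans (*-congˡ (⁻¹-inverse _ oj)) (*-identityʳ _))
             (-‿cong (trans (*-congˡ (⁻¹-inverse _ oi)) (*-identityʳ _))) ⟩
      u i - u j ∎) (*-nonneg 0≤uu (x≤y⇒0≤y-x (inj₁ Xi<Xj))))
      where open SetoidReasoning setoid

    neg-* : ∀ {x y} → - (x * y) ≈ - x * y
    neg-* {x} {y} = solve 2 (λ x y → :- (x :* y) := :- x :* y) refl x y

    neg-minus : ∀ {z x y} → - (z * (x - y)) ≈ z * (y - x)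
    neg-minus {z} {x} {y} = solve 3 (λ z x y → :- (z :* (x :- y)) := z :* (y :- x)) refl z x y

    module _ {i j : Fin n} (oi : OffVertical i) (oj : OffVertical j) where

      sameSide-cup : 0# ≤ dx i * dx j → 0# < det b i j → w i ≤ w j
      sameSide-cup 0≤ 0<det = 0≤y-x⇒x≤y (*-cancel-nonneg 0≤ (<-resp refl (det-pencil oi oj) 0<det))

      sameSide-cap : 0# ≤ dx i * dx j → det b i j < 0# → w j ≤ w i
      sameSide-cap 0≤ det<0 = 0≤y-x⇒x≤y (*-cancel-nonneg 0≤
        (<-resp refl (trans (-‿cong (det-pencil oi oj)) neg-minus) (neg-neg det<0)))

    det-rotate : ∀ i j → det i j b ≈ det b i j
    det-rotate i j = solve 6 (λ x₁ y₁ x₂ y₂ xb yb →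
        (x₂ :- x₁) :* (yb :- y₁) :- (xb :- x₁) :* (y₂ :- y₁)
        := (x₁ :- xb) :* (y₂ :- yb) :- (x₂ :- xb) :* (y₁ :- yb))
      refl (X i) (Y i) (X j) (Y j) (X b) (Y b)

    det-exchange : ∀ i j → det i b j ≈ - det b i j
    det-exchange i j = solve 6 (λ x₁ y₁ x₂ y₂ xb yb →
        (xb :- x₁) :* (y₂ :- y₁) :- (x₂ :- x₁) :* (yb :- y₁)
        := :- ((x₁ :- xb) :* (y₂ :- yb) :- (x₂ :- xb) :* (y₁ :- yb)))
      refl (X i) (Y i) (X j) (Y j) (X b) (Y b)

    module _ {i j : Fin n} (Xi<Xb : X i < X b) (Xb<Xj : X b < X j) where

      private
        0≤- : 0# ≤ - (dx i * dx j)
        0≤- = neg-nonpos (*-nonpos-nonneg (inj₁ (left⇒dx<0 Xi<Xb)) (inj₁ (right⇒0<dx Xb<Xj)))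
        det≈ : det i b j ≈ - (dx i * dx j) * (w j - w i)
        det≈ = trans (det-exchange i j) (trans (-‿cong (det-pencil (left⇒off Xi<Xb) (right⇒off Xb<Xj))) neg-*)

      -- Moving `b` to the middle of the triple changes the sign of the determinant, and having `i`
      -- and `j` on opposite sides of `b` makes `dx i * dx j` negative. The two changes cancel, so
      -- cups raise `w` here just as in `sameSide-cup`.
      across-cup : 0# < det i b j → w i ≤ w j
      across-cup h = 0≤y-x⇒x≤y (*-cancel-nonneg 0≤- (<-resp refl det≈ h))

      across-cap : det i b j < 0# → w j ≤ w i
      across-cap h = 0≤y-x⇒x≤y (*-cancel-nonneg 0≤- (<-resp refl (trans (-‿cong det≈) neg-minus) (neg-neg h)))

    module _ (W : Fin 4 → Indices) (inhabited : ∀ i → ∃[ x ] x List.∈ W i)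
      (before : ∀ {i j} → i Fin.< j → Before (W i) (W j))
      (left : ∀ (i : Fin 2) {x} → x List.∈ W (i Fin.↑ˡ 2) → X x < X b)
      (right : ∀ (i : Fin 2) {x} → x List.∈ W (2 Fin.↑ʳ i) → X b < X x) where

      private
        off : ∀ i {x} → x List.∈ W i → OffVertical x
        off 0F x∈ = left⇒off (left 0F x∈)
        off 1F x∈ = left⇒off (left 1F x∈)
        off 2F x∈ = right⇒off (right 0F x∈)
        off 3F x∈ = right⇒off (right 1F x∈)

        sign : ∀ i → ConstSignOn dx (W i)
        sign 0F = inj₂ λ x∈ → inj₁ (left⇒dx<0 (left 0F x∈))
        sign 1F = inj₂ λ x∈ → inj₁ (left⇒dx<0 (left 1F x∈))
        sign 2F = inj₁ λ x∈ → inj₁ (right⇒0<dx (right 0F x∈))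
        sign 3F = inj₁ λ x∈ → inj₁ (right⇒0<dx (right 1F x∈))

        disjoint : ∀ {i j} → i Fin.< j → Disjoint (W i) (W j)
        disjoint i<j x∈ x∈′ = O.irrefl refl (before i<j x∈ x∈′)

        u-left : Sep u (W 1F) (W 0F)
        u-left x∈ y∈ = u-antitone (off 0F y∈) (off 1F x∈)
          (*-nonpos (u-neg (left 0F y∈)) (u-neg (left 1F x∈))) (before {0F} {1F} (s≤s z≤n) y∈ x∈)

        u-right : Sep u (W 3F) (W 2F)
        u-right x∈ y∈ = u-antitone (off 2F y∈) (off 3F x∈)
          (*-nonneg (u-pos (right 0F y∈)) (u-pos (right 1F x∈))) (before {2F} {3F} (s≤s (s≤s (s≤s z≤n))) y∈ x∈)

        u-across : ∀ (i j : Fin 2) → Sep u (W (i Fin.↑ˡ 2)) (W (2 Fin.↑ʳ j))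
        u-across i j x∈ y∈ = ≤-trans (u-neg (left i x∈)) (u-pos (right j y∈))

        same-left : ∀ {x y} → x List.∈ W 0F → y List.∈ W 1F → 0# ≤ dx x * dx y
        same-left x∈ y∈ = *-nonpos (inj₁ (left⇒dx<0 (left 0F x∈))) (inj₁ (left⇒dx<0 (left 1F y∈)))

        same-right : ∀ {x y} → x List.∈ W 2F → y List.∈ W 3F → 0# ≤ dx x * dx y
        same-right x∈ y∈ = *-nonneg (inj₁ (right⇒0<dx (right 0F x∈))) (inj₁ (right⇒0<dx (right 1F y∈)))

        chain : ∀ v → Sep v (W 0F) (W 1F) → Sep v (W 1F) (W 2F) → Sep v (W 2F) (W 3F) →
                ∀ {i j} → i Fin.< j → Sep v (W i) (W j)
        chain v s t r = up
          where
          s∙t : Sep v (W 0F) (W 2F)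
          s∙t x∈ z∈ = ≤-trans (s x∈ (proj₂ (inhabited 1F))) (t (proj₂ (inhabited 1F)) z∈)
          t∙r : Sep v (W 1F) (W 3F)
          t∙r x∈ z∈ = ≤-trans (t x∈ (proj₂ (inhabited 2F))) (r (proj₂ (inhabited 2F)) z∈)
          s∙t∙r : Sep v (W 0F) (W 3F)
          s∙t∙r x∈ z∈ = ≤-trans (s x∈ (proj₂ (inhabited 1F))) (t∙r (proj₂ (inhabited 1F)) z∈)
          up : ∀ {i j} → i Fin.< j → Sep v (W i) (W j)
          up {0F} {1F} _ = s
          up {0F} {2F} _ = s∙t
          up {0F} {3F} _ = s∙t∙r
          up {1F} {2F} _ = t
          up {1F} {3F} _ = t∙r
          up {2F} {3F} _ = r
          up {1F} {1F} (s≤s ())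
          up {2F} {1F} (s≤s ())
          up {2F} {2F} (s≤s (s≤s ()))
          up {3F} {1F} (s≤s ())
          up {3F} {2F} (s≤s (s≤s ()))
          up {3F} {3F} (s≤s (s≤s (s≤s ())))

      -- Each of the three triples compares `w` on two consecutive clusters, and `chain` supplies
      -- the remaining pairs. Hence a monochromatic path suffices, and the five clusters need not
      -- have all their triples of one kind.
      cup⇒pattern : Cup (W 0F) (W 1F) (b ∷ []) → Cup (W 1F) (b ∷ []) (W 2F) → Cup (b ∷ []) (W 2F) (W 3F) →
                    Pattern2143 pencilChart W
      cup⇒pattern cup₁ cup₂ cup₃ = record
        { dom = off ; sign = ConstSignOn-neg ∘ sign ; disjoint = disjoint
        ; u-left = u-left ; u-right = u-right ; u-across = u-across
        ; w-up = chain w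
            (λ x∈ y∈ → sameSide-cup (off 0F x∈) (off 1F y∈) (same-left x∈ y∈)
              (<-resp refl (det-rotate _ _) (cup₁ x∈ y∈ (here ≡.refl))))
            (λ x∈ y∈ → across-cup (left 1F x∈) (right 0F y∈) (cup₂ x∈ (here ≡.refl) y∈))
            (λ x∈ y∈ → sameSide-cup (off 2F x∈) (off 3F y∈) (same-right x∈ y∈) (cup₃ (here ≡.refl) x∈ y∈)) }

      cap⇒pattern : Cap (W 0F) (W 1F) (b ∷ []) → Cap (W 1F) (b ∷ []) (W 2F) → Cap (b ∷ []) (W 2F) (W 3F) →
                    Pattern2143 (flip-w pencilChart) W
      cap⇒pattern cap₁ cap₂ cap₃ = record
        { dom = off ; sign = λ i → ConstSignOn-neg (ConstSignOn-neg (sign i)) ; disjoint = disjoint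
        ; u-left = u-left ; u-right = u-right ; u-across = u-across
        ; w-up = chain (λ i → - w i)
            (λ x∈ y∈ → neg-mono-≤ (sameSide-cap (off 0F x∈) (off 1F y∈) (same-left x∈ y∈)
              (<-resp (det-rotate _ _) refl (cap₁ x∈ y∈ (here ≡.refl)))))
            (λ x∈ y∈ → neg-mono-≤ (across-cap (left 1F x∈) (right 0F y∈) (cap₂ x∈ (here ≡.refl) y∈)))
            (λ x∈ y∈ → neg-mono-≤ (sameSide-cap (off 2F x∈) (off 3F y∈) (same-right x∈ y∈) (cap₃ (here ≡.refl) x∈ y∈))) }

  on-vertical⇒det≈0 : ∀ {i j l} → X j ≈ X i → X l ≈ X i → det i j l ≈ 0#
  on-vertical⇒det≈0 {i} {j} {l} Xj Xl = trans
    (+-cong (*-congʳ (zero-diff Xj)) (-‿cong (*-congʳ (zero-diff Xl))))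
    (trans (+-cong (zeroˡ _) (-‿cong (zeroˡ _))) (-‿inverseʳ 0#))
    where
    zero-diff : ∀ {x} → x ≈ X i → x - X i ≈ 0#
    zero-diff h = trans (+-congʳ h) (-‿inverseʳ (X i))

  -- Between two blocks lies a third, so equal abscissae would put three points
  -- of the configuration on a vertical line.
  strict : NonDegenerate → ∀ {xs t s} .{{_ : ℕ.NonZero s}} (B : Blocks X xs t s) → let open Blocks B in
           ∀ {i j l} → i Fin.< j → j Fin.< l → Before (block i) (block l)
  strict nondeg {s = s} B {i} {j} {l} i<j j<l {a} {c} a∈ c∈ with block j in eq | |block| j
    where open Blocks B
  strict nondeg {s = suc _} B _ _ a∈ c∈ | [] | ()
  ... | m ∷ _ | _ = ≤∧≉⇒< (sep (Fin.<-trans i<j j<l) a∈ c∈) λ Xa≈Xc →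
      nondeg (λ { ≡.refl → disjoint i<j a∈ m∈ }) (λ { ≡.refl → disjoint (Fin.<-trans i<j j<l) a∈ c∈ })
             (λ { ≡.refl → disjoint j<l m∈ c∈ })
        (on-vertical⇒det≈0 {a} {m} {c}
          (≤-antisym (≤-trans (sep j<l m∈ c∈) (≤-reflexive (sym Xa≈Xc))) (sep i<j a∈ m∈)) (sym Xa≈Xc))
    where
    open Blocks B
    m∈ : m List.∈ block j
    m∈ = ≡.subst (m List.∈_) (≡.sym eq) (here ≡.refl)

-- From a large point set to avoiding families.

triples : ∀ r → List (Fin r × Fin r × Fin r)
triples r = cartesianProduct (allFin r) (cartesianProduct (allFin r) (allFin r))

module Assembly (ℝ : CompleteOrderedField) {n : ℕ} (p : Vector (Plane.Point ℝ) n) where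
  open Configuration ℝ p
  open Selection ℝ p
  open Triples ℝ p
  open Pencil ℝ p
  open Part

  module _ {r : ℕ} (Z : Fin r → Indices)
    (orient : ∀ {i j l} → i Fin.< j → j Fin.< l → Oriented (Z i) (Z j) (Z l)) where

    -- Paths only look at increasing triples; all others get the default `false`.
    isCup : Fin r → Fin r → Fin r → Bool
    isCup i j l with i Fin.<? j | j Fin.<? l
    ... | yes i<j | yes j<l = [ (λ _ → true) , (λ _ → false) ]′ (orient i<j j<l)
    ... | _       | _       = false

    isCup⇒cup : ∀ {i j l} → i Fin.< j → j Fin.< l → isCup i j l ≡ true → Cup (Z i) (Z j) (Z l)
    isCup⇒cup {i} {j} {l} i<j j<l eq with i Fin.<? j | j Fin.<? l
    ... | no i≮j  | _       = contradiction i<j i≮j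
    ... | yes _   | no j≮l  = contradiction j<l j≮l
    ... | yes i<j | yes j<l with orient i<j j<l
    ... | inj₁ cup = cup
    isCup⇒cup _ _ () | yes _ | yes _ | inj₂ _

    ¬isCup⇒cap : ∀ {i j l} → i Fin.< j → j Fin.< l → isCup i j l ≡ false → Cap (Z i) (Z j) (Z l)
    ¬isCup⇒cap {i} {j} {l} i<j j<l eq with i Fin.<? j | j Fin.<? l
    ... | no i≮j  | _       = contradiction i<j i≮j
    ... | yes _   | no j≮l  = contradiction j<l j≮l
    ... | yes i<j | yes j<l with orient i<j j<l
    ... | inj₂ cap = cap
    ¬isCup⇒cap _ _ () | yes _ | yes _ | inj₁ _

  module _ (nondeg : NonDegenerate) {r : ℕ} (r-big : 40 ℕ.≤ r) (k′ q′ : ℕ) where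

    k q m : ℕ
    k = suc k′
    q = suc q′
    m = (k ℕ.* k) ℕ.* ((k ℕ.* k) ℕ.* q)

    orientedClusters⇒families : (Z : Fin r → Indices) → (∀ i → Unique (Z i)) → (∀ i → m ℕ.≤ length (Z i)) →
      (∀ {i j} → i Fin.< j → Before (Z i) (Z j)) →
      (∀ {i j l} → i Fin.< j → j Fin.< l → Oriented (Z i) (Z j) (Z l)) → AvoidingFamilies k q
    orientedClusters⇒families Z Z! big before orient = conclude colour 123≡ 234≡ 345≡
      where
      open MonotonePaths.MonochromaticPath (MonotonePaths.monochromaticPath (isCup Z orient) r-big)
      inhabited : ∀ i → ∃[ x ] x List.∈ Z i
      inhabited i with Z i | big i
      ... | x ∷ _ | _ = x , here ≡.refl
      b : Fin n
      b = proj₁ (inhabited i₃)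
      b∈ : ∀ {x} → x List.∈ b ∷ [] → x List.∈ Z i₃
      b∈ (here ≡.refl) = proj₂ (inhabited i₃)
      index : Fin 4 → Fin r
      index 0F = i₁
      index 1F = i₂
      index 2F = i₄
      index 3F = i₅
      2<4 : i₂ Fin.< i₄
      2<4 = Fin.<-trans 2<3 3<4
      increasing : ∀ {i j} → i Fin.< j → index i Fin.< index j
      increasing {0F} {1F} _ = 1<2
      increasing {0F} {2F} _ = Fin.<-trans 1<2 2<4
      increasing {0F} {3F} _ = Fin.<-trans 1<2 (Fin.<-trans 2<4 4<5)
      increasing {1F} {2F} _ = 2<4
      increasing {1F} {3F} _ = Fin.<-trans 2<4 4<5
      increasing {2F} {3F} _ = 4<5
      increasing {1F} {1F} (s≤s ())
      increasing {2F} {1F} (s≤s ())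
      increasing {2F} {2F} (s≤s (s≤s ()))
      increasing {3F} {1F} (s≤s ())
      increasing {3F} {2F} (s≤s (s≤s ()))
      increasing {3F} {3F} (s≤s (s≤s (s≤s ())))
      W : Fin 4 → Indices
      W = Z ∘ index
      left : ∀ (i : Fin 2) {x} → x List.∈ W (i Fin.↑ˡ 2) → _
      left 0F x∈ = before (Fin.<-trans 1<2 2<3) x∈ (b∈ (here ≡.refl))
      left 1F x∈ = before 2<3 x∈ (b∈ (here ≡.refl))
      right : ∀ (i : Fin 2) {x} → x List.∈ W (2 Fin.↑ʳ i) → _
      right 0F x∈ = before 3<4 (b∈ (here ≡.refl)) x∈
      right 1F x∈ = before (Fin.<-trans 3<4 4<5) (b∈ (here ≡.refl)) x∈
      conclude : ∀ c → isCup Z orient i₁ i₂ i₃ ≡ c → isCup Z orient i₂ i₃ i₄ ≡ c →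
                 isCup Z orient i₃ i₄ i₅ ≡ c → AvoidingFamilies k q
      conclude true c₁ c₂ c₃ = pattern⇒families nondeg
        (cup⇒pattern b W (inhabited ∘ index) (before ∘ increasing) left right
          (λ x∈ y∈ z∈ → isCup⇒cup Z orient 1<2 2<3 c₁ x∈ y∈ (b∈ z∈))
          (λ x∈ y∈ z∈ → isCup⇒cup Z orient 2<3 3<4 c₂ x∈ (b∈ y∈) z∈)
          (λ x∈ y∈ z∈ → isCup⇒cup Z orient 3<4 4<5 c₃ (b∈ x∈) y∈ z∈))
        k′ q′ (Z! ∘ index) (big ∘ index)
      conclude false c₁ c₂ c₃ = pattern⇒families nondeg
        (cap⇒pattern b W (inhabited ∘ index) (before ∘ increasing) left right
          (λ x∈ y∈ z∈ → ¬isCup⇒cap Z orient 1<2 2<3 c₁ x∈ y∈ (b∈ z∈))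
          (λ x∈ y∈ z∈ → ¬isCup⇒cap Z orient 2<3 3<4 c₂ x∈ (b∈ y∈) z∈)
          (λ x∈ y∈ z∈ → ¬isCup⇒cap Z orient 3<4 4<5 c₃ (b∈ x∈) y∈ z∈))
        k′ q′ (Z! ∘ index) (big ∘ index)

    families : (r ℕ.* 2) ℕ.* (2 ℕ.^ length (triples r) ℕ.* m) ℕ.≤ n → AvoidingFamilies k q
    families big = orientedClusters⇒families (members ∘ P) (unique ∘ P) (size ∘ P)
      (λ {i} {j} i<j a∈ b∈ → before i<j (⊆whole (P i) a∈) (⊆whole (P j) b∈))
      (λ {i} {j} {l} i<j j<l → All.lookup (proj₂ oriented)
        (∈-cartesianProduct⁺ (∈-allFin i) (∈-cartesianProduct⁺ (∈-allFin j) (∈-allFin l))) i<j j<l)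
      where
      s = 2 ℕ.^ length (triples r) ℕ.* m
      instance
        m≢0 : ℕ.NonZero m
        m≢0 = ℕ.m*n≢0 (k ℕ.* k) ((k ℕ.* k) ℕ.* q)
        s≢0 : ℕ.NonZero s
        s≢0 = ℕ.m*n≢0 (2 ℕ.^ length (triples r)) m {{ℕ.m^n≢0 2 (length (triples r))}}
      -- There are twice as many blocks as clusters: those numbered by `between` are dropped and
      -- only make the abscissae of their neighbours strictly different.
      B = blocks X (allFin n) (r ℕ.* 2) s (Unique.allFin⁺ n)
        (≡.subst ((r ℕ.* 2) ℕ.* s ℕ.≤_) (≡.sym (List.length-tabulate {n = n} id)) big)
      open Blocks B
      even : Fin r → Fin (r ℕ.* 2)
      even i = Fin.combine i 0F
      between : Fin r → Fin (r ℕ.* 2)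
      between i = Fin.combine i 1F
      before : ∀ {i j} → i Fin.< j → Before (block (even i)) (block (even j))
      before {i} {j} i<j = strict nondeg B {even i} {between i} {even j}
        (≡.subst₂ ℕ._<_ (≡.sym (Fin.toℕ-combine i 0F)) (≡.sym (Fin.toℕ-combine i 1F)) (ℕ.+-monoʳ-< (2 ℕ.* Fin.toℕ i) (s≤s z≤n)))
        (Fin.combine-monoˡ-< 1F 0F i<j)
      oriented = orientAll nondeg m (triples r) (block ∘ even) (block! ∘ even)
        (λ i → ℕ.≤-reflexive (≡.sym (|block| (even i)))) before
      P = proj₁ oriented

-- Passage to subsets and the density estimate.

toSubset : ∀ {n} → List (Fin n) → Subset n
toSubset = foldr (λ x S → ⁅ x ⁆ ∪ S) ⊥

∈-toSubset⁻ : ∀ {n} (xs : List (Fin n)) {x} → x ∈ toSubset xs → x List.∈ xs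
∈-toSubset⁻ []       x∈ = contradiction x∈ ∉⊥
∈-toSubset⁻ (y ∷ xs) x∈ with x∈p∪q⁻ ⁅ y ⁆ (toSubset xs) x∈
... | inj₁ x∈⁅y⁆ = here (x∈⁅y⁆⇒x≡y y x∈⁅y⁆)
... | inj₂ x∈xs  = there (∈-toSubset⁻ xs x∈xs)

length≤∣toSubset∣ : ∀ {n} {xs : List (Fin n)} → Unique xs → length xs ℕ.≤ ∣ toSubset xs ∣
length≤∣toSubset∣ [] = z≤n
length≤∣toSubset∣ {n} {x ∷ xs} (x∉ ∷ xs!) = ℕ.≤-trans
  (s≤s (ℕ.≤-trans (length≤∣toSubset∣ xs!) (p⊆q⇒∣p∣≤∣q∣ shrink)))
  (x∈p⇒∣p-x∣<∣p∣ {p = whole} (x∈p∪q⁺ {q = toSubset xs} (inj₁ (x∈⁅x⁆ x))))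
  where
  whole : Subset n
  whole = toSubset (x ∷ xs)
  shrink : toSubset xs Subset.⊆ whole Subset.- x
  shrink y∈ = x∈p∧x≢y⇒x∈p-y (x∈p∪q⁺ {p = ⁅ x ⁆} (inj₂ y∈))
    λ { ≡.refl → All.lookup x∉ (∈-toSubset⁻ xs y∈) ≡.refl }

-- Among 40 clusters there is a monochromatic path on 5 of them; orienting the
-- triples of clusters one after the other halves the clusters each time.  The
-- definition is abstract to keep this number from being evaluated.
abstract

  scale : ℕ
  scale = (40 ℕ.* 2) ℕ.* 2 ℕ.^ length (triples 40)

  scale≢0 : ℕ.NonZero scale
  scale≢0 = ℕ.m*n≢0 (40 ℕ.* 2) (2 ℕ.^ length (triples 40)) {{_}} {{ℕ.m^n≢0 2 (length (triples 40))}}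

  scaledFamilies : ∀ ℝ {n} (p : Vector (Plane.Point ℝ) n) → let open Configuration ℝ p in
    NonDegenerate → ∀ k′ q′ → scale ℕ.* (suc k′ ℕ.^ 4 ℕ.* suc q′) ℕ.≤ n → AvoidingFamilies (suc k′) (suc q′)
  scaledFamilies ℝ p nondeg k′ q′ big = Assembly.families ℝ p nondeg {40} ℕ.≤-refl k′ q′
    (ℕ.≤-trans (ℕ.≤-reflexive (rearrange (40 ℕ.* 2) (2 ℕ.^ length (triples 40)) (suc k′) (suc q′))) big)
    where
    rearrange : ∀ r e k q → r ℕ.* (e ℕ.* ((k ℕ.* k) ℕ.* ((k ℕ.* k) ℕ.* q))) ≡ r ℕ.* e ℕ.* (k ℕ.^ 4 ℕ.* q)
    rearrange = solve 4 (λ r e k q → r :* (e :* ((k :* k) :* ((k :* k) :* q))) := r :* e :* (k :^ 4 :* q)) ≡.refl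
      where open +-*-Solver

module Densities (ℝ : CompleteOrderedField) where
  open OrderedField ℝ
  open Mult semiring using (×1-homo-*)

  0≤fromℕ : ∀ n → 0# ≤ fromℕ n
  0≤fromℕ zero    = ≤-refl
  0≤fromℕ (suc n) = +-nonneg (inj₁ 0<1) (0≤fromℕ n)

  0<fromℕ : ∀ n .{{_ : ℕ.NonZero n}} → 0# < fromℕ n
  0<fromℕ (suc n) = <-≤-trans 0<1 (≤-resp (+-identityʳ 1#) refl (+-mono-≤ ≤-refl (0≤fromℕ n)))

  fromℕ-mono : ∀ {m n} → m ℕ.≤ n → fromℕ m ≤ fromℕ n
  fromℕ-mono {n = n} z≤n = 0≤fromℕ n
  fromℕ-mono (s≤s m≤n) = +-mono-≤ ≤-refl (fromℕ-mono m≤n)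

  ^-pos : ∀ {x} → 0# < x → ∀ n → 0# < x ^ n
  ^-pos h zero    = 0<1
  ^-pos h (suc n) = *-pos h (^-pos h n)

  fromℕ-^ : ∀ k n → fromℕ (k ℕ.^ n) ≈ fromℕ k ^ n
  fromℕ-^ k zero    = +-identityʳ 1#
  fromℕ-^ k (suc n) = trans (×1-homo-* k (k ℕ.^ n)) (*-congˡ (fromℕ-^ k n))

  module _ (C : ℕ) .{{_ : ℕ.NonZero C}} where

    c : Carrier
    c = fromℕ C ⁻¹

    0<c : 0# < c
    0<c = ⁻¹-pos (0<fromℕ C)

    density-bound : ∀ k .{{_ : ℕ.NonZero k}} {n s} → n ℕ.≤ C ℕ.* (k ℕ.^ 4 ℕ.* s) →
                    (c / fromℕ k ^ 4) * fromℕ n ≤ fromℕ s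
    density-bound k {n} {s} n≤ = ≤-resp refl cancel
      (*-monoˡ-≤ (*-nonneg (inj₁ 0<c) (inj₁ (⁻¹-pos 0<k⁴))) (fromℕ-mono n≤))
      where
      open SetoidReasoning setoid
      K = fromℕ k ^ 4
      0<k⁴ : 0# < K
      0<k⁴ = ^-pos (0<fromℕ k) 4
      cancel : (c / K) * fromℕ (C ℕ.* (k ℕ.^ 4 ℕ.* s)) ≈ fromℕ s
      cancel = begin
        (c * K ⁻¹) * fromℕ (C ℕ.* (k ℕ.^ 4 ℕ.* s))
          ≈⟨ *-congˡ (trans (×1-homo-* C (k ℕ.^ 4 ℕ.* s)) (*-congˡ
               (trans (×1-homo-* (k ℕ.^ 4) s) (*-congʳ (fromℕ-^ k 4))))) ⟩
        (c * K ⁻¹) * (fromℕ C * (K * fromℕ s))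
          ≈⟨ solve 5 (λ c i C K s → (c :* i) :* (C :* (K :* s)) := (C :* c) :* ((K :* i) :* s))
               refl c (K ⁻¹) (fromℕ C) K (fromℕ s) ⟩
        (fromℕ C * c) * ((K * K ⁻¹) * fromℕ s)
          ≈⟨ *-cong (⁻¹-inverse _ (>⇒≉ (0<fromℕ C))) (*-congʳ (⁻¹-inverse _ (>⇒≉ 0<k⁴))) ⟩
        1# * (1# * fromℕ s)
          ≈⟨ trans (*-identityˡ _) (*-identityˡ _) ⟩
        fromℕ s ∎

-- The quotient is at least 1, so the remainder, being less than `D`, is absorbed by a second copy
-- of `D` times the quotient. This is the factor 2 in `C`.
n≤2D*[n/D] : ∀ D .{{_ : ℕ.NonZero D}} n → D ℕ.≤ n → n ℕ.≤ D ℕ.* (n ℕ./ D) ℕ.+ D ℕ.* (n ℕ./ D)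
n≤2D*[n/D] D n D≤n = begin
  n                                          ≡⟨ ℕ.m≡m%n+[m/n]*n n D ⟩
  n ℕ.% D ℕ.+ (n ℕ./ D) ℕ.* D                ≤⟨ ℕ.+-monoˡ-≤ _ (ℕ.<⇒≤ (ℕ.m%n<n n D)) ⟩
  D ℕ.+ (n ℕ./ D) ℕ.* D                      ≤⟨ ℕ.+-mono-≤ (ℕ.≤-trans (ℕ.≤-reflexive (≡.sym (ℕ.*-identityʳ D)))
                                                  (ℕ.*-monoʳ-≤ D (ℕ.m≥n⇒m/n>0 D≤n))) (ℕ.≤-reflexive (ℕ.*-comm (n ℕ./ D) D)) ⟩
  D ℕ.* (n ℕ./ D) ℕ.+ D ℕ.* (n ℕ./ D)        ∎
  where open ℕ.≤-Reasoning

C : ℕ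
C = 2 ℕ.* scale

instance
  scale-nonZero : ℕ.NonZero scale
  scale-nonZero = scale≢0

  C-nonZero : ℕ.NonZero C
  C-nonZero = ℕ.m*n≢0 2 scale

threshold : ℕ → ℕ
threshold k = scale ℕ.* k ℕ.^ 4

twice : ∀ s x q → s ℕ.* x ℕ.* q ℕ.+ s ℕ.* x ℕ.* q ≡ 2 ℕ.* s ℕ.* (x ℕ.* q)
twice = solve 3 (λ s x q → s :* x :* q :+ s :* x :* q := con 2 :* s :* (x :* q)) ≡.refl
  where open +-*-Solver

module _ (ℝ : CompleteOrderedField) where
  open OrderedField ℝ
  open Plane ℝ
  open Densities ℝ

  DenseAvoidingSubsets : Carrier → ℕ → ∀ {n} → Vector Point n → Set
  DenseAvoidingSubsets ε k {n} p =
    Σ[ A ∈ (Fin k → Subset n) ] Σ[ B ∈ (Fin k → Subset n) ]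
      PairwiseDisjoint [ A , B ]′ ×
      (∀ i → ε * fromℕ n ≤ fromℕ ∣ A i ∣) ×
      (∀ i → ε * fromℕ n ≤ fromℕ ∣ B i ∣) ×
      ((a b : Fin k → Fin n) → (∀ i → a i ∈ A i) → (∀ i → b i ∈ B i) →
       MutuallyAvoiding (range (p ∘ a)) (range (p ∘ b)))

  families⇒subsets : ∀ {ε k q n} (p : Vector Point n) → ε * fromℕ n ≤ fromℕ q →
    Configuration.AvoidingFamilies ℝ p k q → DenseAvoidingSubsets ε k p
  families⇒subsets {ε} {k} {q} {n} p dense fams = A , B , disjoint ,
    (λ i → ≤-trans dense (fromℕ-mono (ℕ.≤-trans (size F i) (length≤∣toSubset∣ (unique F i))))) ,
    (λ i → ≤-trans dense (fromℕ-mono (ℕ.≤-trans (size G i) (length≤∣toSubset∣ (unique G i))))) ,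
    λ a b a∈ b∈ → avoiding a b (λ i → ∈-toSubset⁻ (cell F i) (a∈ i)) (λ i → ∈-toSubset⁻ (cell G i) (b∈ i))
    where
    open Configuration ℝ p
    open AvoidingFamilies fams
    open Family hiding (disjoint)
    A B : Fin k → Subset n
    A i = toSubset (cell F i)
    B i = toSubset (cell G i)
    common : ∀ xs ys {x} → x ∈ toSubset xs Subset.∩ toSubset ys → x List.∈ xs × x List.∈ ys
    common xs ys x∈ = let x∈xs , x∈ys = x∈p∩q⁻ (toSubset xs) (toSubset ys) x∈ in
      ∈-toSubset⁻ xs x∈xs , ∈-toSubset⁻ ys x∈ys
    disjoint : PairwiseDisjoint [ A , B ]′
    disjoint (inj₁ i) (inj₁ j) i≢j (x , x∈) = let x∈i , x∈j = common (cell F i) (cell F j) x∈ in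
      Family.disjoint F (i≢j ∘ ≡.cong inj₁) x∈i x∈j
    disjoint (inj₁ i) (inj₂ j) _ (x , x∈) = let x∈i , x∈j = common (cell F i) (cell G j) x∈ in
      U∩V=∅ (cell⊆ F i x∈i) (cell⊆ G j x∈j)
    disjoint (inj₂ i) (inj₁ j) _ (x , x∈) = let x∈i , x∈j = common (cell G i) (cell F j) x∈ in
      U∩V=∅ (cell⊆ F j x∈j) (cell⊆ G i x∈i)
    disjoint (inj₂ i) (inj₂ j) i≢j (x , x∈) = let x∈i , x∈j = common (cell G i) (cell G j) x∈ in
      Family.disjoint G (i≢j ∘ ≡.cong inj₂) x∈i x∈j

  -- The cells get n / D points, the most that `scaledFamilies` allows; the threshold `D` on `n` is
  -- what makes this number positive.
  dense-avoiding : ∀ k′ n → threshold (suc k′) ℕ.≤ n →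
    (p : Vector Point n) → Injective _≡_ _≈ₚ_ p → GeneralPosition (range p) →
    DenseAvoidingSubsets (c C / fromℕ (suc k′) ^ 4) (suc k′) p
  dense-avoiding k′ n D≤n p inj gp = withQuotient (n ℕ./ D) (ℕ.m≥n⇒m/n>0 D≤n)
      (ℕ.≤-trans (ℕ.≤-reflexive (ℕ.*-comm D (n ℕ./ D))) (ℕ.m/n*n≤m n D)) (n≤2D*[n/D] D n D≤n)
    where
    k D : ℕ
    k = suc k′
    D = threshold k
    instance
      D-nonZero : ℕ.NonZero D
      D-nonZero = ℕ.m*n≢0 scale (k ℕ.^ 4) {{scale≢0}} {{ℕ.m^n≢0 k 4}}
    withQuotient : ∀ q → 0 ℕ.< q → D ℕ.* q ℕ.≤ n → n ℕ.≤ D ℕ.* q ℕ.+ D ℕ.* q →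
                   DenseAvoidingSubsets (c C / fromℕ k ^ 4) k p
    withQuotient (suc q′) _ lower upper = families⇒subsets p
      (density-bound C k (ℕ.≤-trans upper (ℕ.≤-reflexive (twice scale (k ℕ.^ 4) (suc q′)))))
      (scaledFamilies ℝ p (Configuration.nonDegenerate ℝ p inj gp) k′ q′
        (ℕ.≤-trans (ℕ.≤-reflexive (≡.sym (ℕ.*-assoc scale (k ℕ.^ 4) (suc q′)))) lower))

theorem1p4 : (ℝ : CompleteOrderedField) →
    let open CompleteOrderedField ℝ
        open Plane ℝ
    in
    Σ[ c ∈ Carrier ] (0# < c) ×
      ((k : ℕ) → 0 ℕ.< k →
        Σ[ ε ∈ Carrier ] (0# < ε) × (c / fromℕ k ^ 4 ≤ ε) ×
        (Σ[ N ∈ ℕ ]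
          ((n : ℕ) → N ℕ.≤ n →
           (p : Vector Point n) → Injective _≡_ _≈ₚ_ p → GeneralPosition (range p) →
           Σ[ A ∈ (Fin k → Subset n) ] Σ[ B ∈ (Fin k → Subset n) ]
             PairwiseDisjoint [ A , B ]′ ×
             (∀ i → ε * fromℕ n ≤ fromℕ ∣ A i ∣) ×
             (∀ i → ε * fromℕ n ≤ fromℕ ∣ B i ∣) ×
             ((a b : Fin k → Fin n) → (∀ i → a i ∈ A i) → (∀ i → b i ∈ B i) →
              MutuallyAvoiding (range (p ∘ a)) (range (p ∘ b))))))
theorem1p4 ℝ = c C , 0<c C , λ { (suc k′) _ →
    c C / fromℕ (suc k′) ^ 4 , *-pos (0<c C) (⁻¹-pos (^-pos (0<fromℕ (suc k′)) 4)) , ≤-refl ,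
    threshold (suc k′) , dense-avoiding ℝ k′ }
  where
  open OrderedField ℝ using (_/_; _^_; fromℕ; *-pos; ⁻¹-pos; ≤-refl)
  open Densities ℝ
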